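{- Let $F$ and $H$ be $r$-regular non-isomorphic cospectral graphs. Then for every graph $G$: (a) $F\veebar G$ and $H\veebar G$ are $\{A,Q,L\}$NICS; (b) $F\underset{=}{\vee}G$ and $H\underset{=}{\vee}G$ are $\{A,Q,L\}$NICS.
   Context: Graphs are finite, undirected and simple. $A(G)$ is the adjacency matrix, $D(G)$ the diagonal matrix of vertex degrees, $L(G)=D(G)-A(G)$ the Laplacian, $Q(G)=D(G)+A(G)$ the signless Laplacian. For $X\in\{A,L,Q\}$ the $X$-spectrum of $G$ is the multiset of eigenvalues of $X(G)$; two graphs are $X$-cospectral if they have the same $X$-spectrum. For a set $S$ of such matrix types, two graphs are $S$NICS if they are non-isomorphic and $X$-cospectral for every $X\in S$. Two regular graphs are called cospectral if they have the same adjacency spectrum (for regular graphs this is equivalent to being $L$-cospectral or $Q$-cospectral). For vertex-disjoint graphs $G_1$ (with $V(G_1)=\{u_1,\dots,u_{n}\}$) and $G_2$, the join $G_1\vee G_2$ is the disjoint union together with all edges between $V(G_1)$ and $V(G_2)$. The NS (Neighbors Splitting) join $G_1\veebar G_2$ is obtained from $G_1\vee G_2$ by adding new vertices $u_1',\dots,u_{n}'$ and joining $u_i'$ to $u_j$ if and only if $u_iu_j\in E(G_1)$. The NNS (Non Neighbors Splitting) join $G_1\underset{=}{\vee}G_2$ is obtained from $G_1\vee G_2$ by adding new vertices $u_1',\dots,u_{n}'$ and joining $u_i'$ to $u_j$ if and only if $i\ne j$ and $u_iu_j\notin E(G_1)$. -}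

module Defs where

open import Algebra.Apartness.Bundles using (HeytingField)
open import Algebra.Bundles using (CommutativeRing; Semiring)
import Algebra.Definitions.RawSemiring as RawSemiringDefinitions
open import Data.Bool.Base using (Bool; true; false; not; _∧_; if_then_else_)
open import Data.Fin.Base using (Fin; zero; suc; toℕ; splitAt; punchIn)
open import Data.Fin.Properties using (_≟_)
open import Data.Fin.Subset using (Subset; ∣_∣)
open import Data.List.Base using (List; length; foldr)
open import Data.List.Membership.Propositional using (_∈_)
open import Data.Nat.Base using (ℕ; zero; suc)
import Data.Nat.Base as ℕ
open import Data.Product.Base using (Σ; ∃; _×_)
open import Data.Sum.Base using ([_,_]′)
open import Data.Vec.Base using (tabulate)
open import Function.Base using (_∘_)
open import Function.Bundles using (_↔_; Inverse)
open import Level using (Level; _⊔_) renaming (suc to lsuc)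
open import Relation.Binary.PropositionalEquality using (_≡_; refl)
open import Relation.Nullary.Decidable.Core using (does)
open import Relation.Nullary.Negation.Core using (¬_)

record Graph (n : ℕ) : Set where
  field
    adj    : Fin n → Fin n → Bool
    sym    : ∀ i j → adj i j ≡ adj j i
    irrefl : ∀ i → adj i i ≡ false

open Graph public using (adj)

neighbours : ∀ {n} → Graph n → Fin n → Subset n
neighbours G i = tabulate (adj G i)

degree : ∀ {n} → Graph n → Fin n → ℕ
degree G i = ∣ neighbours G i ∣

Regular : ∀ {n} → ℕ → Graph n → Set
Regular r G = ∀ i → degree G i ≡ r

infix 4 _≅_

_≅_ : ∀ {m n} → Graph m → Graph n → Set
_≅_ {m} {n} G H =
  Σ (Fin m ↔ Fin n) λ f →
    ∀ i j → adj G i j ≡ adj H (Inverse.to f i) (Inverse.to f j)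

data JoinVertex (n m : ℕ) : Set where
  u  : Fin n → JoinVertex n m
  u′ : Fin n → JoinVertex n m
  v  : Fin m → JoinVertex n m

joinVertex : ∀ n m → Fin (n ℕ.+ (n ℕ.+ m)) → JoinVertex n m
joinVertex n m = [ u , [ u′ , v ]′ ∘ splitAt n ]′ ∘ splitAt n

-- The join of F and G, plus new vertices u′ i with u′ i adjacent to u j
-- exactly when link i j holds (and to nothing else).
module _ {n m} (link : Fin n → Fin n → Bool) (F : Graph n) (G : Graph m) where

  joinAdj : JoinVertex n m → JoinVertex n m → Bool
  joinAdj (u i)  (u j)  = adj F i j
  joinAdj (u i)  (u′ j) = link j i
  joinAdj (u _)  (v _)  = true
  joinAdj (u′ i) (u j)  = link i j
  joinAdj (u′ _) (u′ _) = false
  joinAdj (u′ _) (v _)  = false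
  joinAdj (v _)  (u _)  = true
  joinAdj (v _)  (u′ _) = false
  joinAdj (v i)  (v j)  = adj G i j

  joinAdj-sym : ∀ x y → joinAdj x y ≡ joinAdj y x
  joinAdj-sym (u i)  (u j)  = Graph.sym F i j
  joinAdj-sym (u _)  (u′ _) = refl
  joinAdj-sym (u _)  (v _)  = refl
  joinAdj-sym (u′ _) (u _)  = refl
  joinAdj-sym (u′ _) (u′ _) = refl
  joinAdj-sym (u′ _) (v _)  = refl
  joinAdj-sym (v _)  (u _)  = refl
  joinAdj-sym (v _)  (u′ _) = refl
  joinAdj-sym (v i)  (v j)  = Graph.sym G i j

  joinAdj-irrefl : ∀ x → joinAdj x x ≡ false
  joinAdj-irrefl (u i)  = Graph.irrefl F i
  joinAdj-irrefl (u′ _) = refl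
  joinAdj-irrefl (v i)  = Graph.irrefl G i

  splittingJoin : Graph (n ℕ.+ (n ℕ.+ m))
  splittingJoin = record
    { adj    = λ i j → joinAdj (joinVertex n m i) (joinVertex n m j)
    ; sym    = λ i j → joinAdj-sym (joinVertex n m i) (joinVertex n m j)
    ; irrefl = λ i → joinAdj-irrefl (joinVertex n m i)
    }

infixl 6 _⊻_ _⩣_

-- NS join
_⊻_ : ∀ {n m} → Graph n → Graph m → Graph (n ℕ.+ (n ℕ.+ m))
F ⊻ G = splittingJoin (adj F) F G

-- NNS join
_⩣_ : ∀ {n m} → Graph n → Graph m → Graph (n ℕ.+ (n ℕ.+ m))
F ⩣ G = splittingJoin (λ i j → not (does (i ≟ j)) ∧ not (adj F i j)) F G

data MatrixType : Set where
  A L Q : MatrixType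

-- The role of ℂ is played by an arbitrary algebraically closed field of
-- characteristic zero.  Inequality is an apartness relation; classically
-- x # y can be read as ¬ (x ≈ y).
record AlgebraicallyClosedCharZeroField c ℓ₁ ℓ₂ : Set (lsuc (c ⊔ ℓ₁ ⊔ ℓ₂)) where
  field
    heytingField : HeytingField c ℓ₁ ℓ₂

  open HeytingField heytingField public

  commutativeRing : CommutativeRing c ℓ₁
  commutativeRing = record { isCommutativeRing = isCommutativeRing }

  open CommutativeRing commutativeRing public using (semiring)

  open RawSemiringDefinitions (Semiring.rawSemiring semiring) public
    using (sum; _^_) renaming (_×_ to _·_)

  field
    characteristicZero : ∀ n → (suc n · 1#) # 0#

    -- Every monic polynomial of positive degree has a root.
    root : ∀ {n} (a : Fin (suc n) → Carrier) →
           ∃ λ x → x ^ suc n + sum (λ i → a i * x ^ toℕ i) ≈ 0#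

module Spectra {c ℓ₁ ℓ₂ : Level} (K : AlgebraicallyClosedCharZeroField c ℓ₁ ℓ₂) where

  open AlgebraicallyClosedCharZeroField K
    using (Carrier; _≈_; _+_; _*_; _-_; -_; 0#; 1#; sum; _^_; _·_)

  Matrix : ℕ → Set c
  Matrix n = Fin n → Fin n → Carrier

  diagonal : ∀ {n} → (Fin n → Carrier) → Matrix n
  diagonal d i j = if does (i ≟ j) then d i else 0#

  -- Laplace expansion along the first row.
  det : ∀ {n} → Matrix n → Carrier
  det {zero}  M = 1#
  det {suc n} M =
    sum λ k → (- 1#) ^ toℕ k * M zero k * det (λ i j → M (suc i) (punchIn k j))

  characteristicPolynomial : ∀ {n} → Matrix n → Carrier → Carrier
  characteristicPolynomial M x = det λ i j → diagonal (λ _ → x) i j - M i j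

  -- The list λs enumerates the eigenvalues of M with their multiplicities as
  -- roots of the characteristic polynomial.  Since K is infinite, equality
  -- at every point of K is equality of polynomials.
  record IsSpectrum {n} (M : Matrix n) (λs : List Carrier) : Set (c ⊔ ℓ₁) where
    field
      length≡n : length λs ≡ n
      factors  : ∀ x → characteristicPolynomial M x
                         ≈ foldr (λ λᵢ p → (x - λᵢ) * p) 1# λs

  adjacency : ∀ {n} → Graph n → Matrix n
  adjacency G i j = if adj G i j then 1# else 0#

  degrees : ∀ {n} → Graph n → Matrix n
  degrees G = diagonal λ i → degree G i · 1#

  matrix : ∀ {n} → MatrixType → Graph n → Matrix n
  matrix A G i j = adjacency G i j
  matrix L G i j = degrees G i j - adjacency G i j
  matrix Q G i j = degrees G i j + adjacency G i j

  -- A common enumeration of both spectra.  Every matrix over K has a spectrum,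
  -- as K is algebraically closed; classically it is unique as a multiset.
  Cospectral : ∀ {m n} → MatrixType → Graph m → Graph n → Set (c ⊔ ℓ₁)
  Cospectral X G H =
    ∃ λ λs → IsSpectrum (matrix X G) λs × IsSpectrum (matrix X H) λs

  NICS : ∀ {m n} → List MatrixType → Graph m → Graph n → Set (c ⊔ ℓ₁)
  NICS S G H = ¬ (G ≅ H) × (∀ X → X ∈ S → Cospectral X G H)

{-# OPTIONS --safe #-}

-- Write x I - X(Γ) of a splitting join Γ in blocks along u, u′, v.  The u′ block
-- is scalar, so eliminating it leaves in the u block a matrix p(A) + t J, where
-- A = A(F) and p is quadratic: the square of the link matrix (A or J - I - A)
-- is A² + β A + γ I + κ J.  The rest of the matrix meets the u block only
-- through the all-ones vector, an eigenvector of A, so bordering by one row and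
-- column splits off det p(A), and the other factor does not depend on F.  Over
-- an algebraically closed field p factors, and det p(A) is a product of two
-- values of the characteristic polynomial of A.  All divisions are cleared by
-- a monic polynomial in x, which can be cancelled as the field is infinite.
--
-- An isomorphism of the joins maps u′ vertices to u′ vertices, which are those of
-- minimal degree s, and hence u vertices, which are their neighbours, to u
-- vertices.

module Submission where

open import Defs
open import Algebra.Bundles using (CommutativeMonoid; CommutativeRing; RawRing)
open import Data.Bool.Base using (Bool; true; false; not; _∧_; if_then_else_)
open import Data.Empty using (⊥-elim)
open import Data.Fin.Base using (Fin; zero; suc; toℕ; punchIn; inject₁; splitAt; _≤_; _↑ˡ_; _↑ʳ_)
open import Data.Fin.Properties
  using (_≟_; toℕ-inject₁; splitAt-↑ˡ; splitAt-↑ʳ; splitAt⁻¹-↑ˡ; splitAt⁻¹-↑ʳ)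
open import Data.Fin.Subset using (∣_∣)
open import Data.List.Base using (List; []; _∷_; length; foldr)
open import Data.Maybe.Base using (Maybe; just; nothing)
open import Data.Nat.Base using (ℕ; zero; suc; _<_; z≤n; s≤s)
import Data.Nat.Base as ℕ
import Data.Nat.Properties as ℕ
open import Data.Product.Base using (∃; _×_; _,_; proj₁; proj₂)
open import Data.Sum.Base using (_⊎_; inj₁; inj₂; [_,_]′; map₁)
open import Data.Unit.Polymorphic.Base using (⊤; tt)
open import Data.Vec.Base using (tabulate)
open import Data.Vec.Functional using (_++_; head; tail; insertAt; removeAt) renaming (_∷_ to _◂_)
open import Data.Vec.Properties using (tabulate-cong)
open import Function.Base using (_∘_)
open import Function.Bundles using (_↔_; Inverse; mk↔ₛ′)
open import Function.Construct.Identity using (↔-id)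
open import Level using (_⊔_; Lift; lift)
open import Relation.Binary.PropositionalEquality using (_≡_)
import Relation.Binary.PropositionalEquality as ≡
open import Relation.Nullary.Decidable.Core using (does; yes; no)
open import Relation.Nullary.Negation.Core using (¬_)

-- Determinants are given by a recursive formula only. All that is needed about them comes from one
-- uniqueness principle: an alternating functional of the rows is `det` times its value at the
-- identity. Multiplicativity and the extraction of `det p(A)` from a larger determinant are both
-- instances of it, for functionals obtained from `det` by mapping rows linearly and by freezing
-- some of them. Equality in the field is not assumed decidable, so there is no case split on
-- whether a divisor vanishes: elimination and bordering scale rows and columns instead. For fixed
-- `x` the scale factors are powers of μ, the diagonal entry at the u′ vertices, and the eigenvalue
-- -μ (y - ρ) (z - ρ) of the all-ones vector, with ρ the valency and y, z the roots of p. The roots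
-- are found separately for each `x`, but the eigenvalue is symmetric in them and hence polynomial
-- in `x`. On the combinatorial side, recognising the u′ vertices by their degree needs `0 < r` and
-- `0 < s`. Both follow from non-isomorphism, as there is only one edgeless and one complete graph
-- of each order.

module FiniteSum {c ℓ} (M : CommutativeMonoid c ℓ) where
  open CommutativeMonoid M
  open import Algebra.Properties.CommutativeMonoid.Sum M

  sum-zero : ∀ {n} {f : Fin n → Carrier} → (∀ i → f i ≈ ε) → sum f ≈ ε
  sum-zero {n} f≈ε = trans (sum-cong-≋ f≈ε) (sum-replicate-zero n)

  sum-ifˡ : ∀ {n} (i : Fin n) (f : Fin n → Carrier) → sum (λ k → if does (i ≟ k) then f k else ε) ≈ f i
  sum-ifˡ {suc n} zero    f = trans (∙-congˡ (sum-zero {n} {f = λ _ → ε} λ _ → refl)) (identityʳ _)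
  sum-ifˡ         (suc i) f = trans (identityˡ _) (sum-ifˡ i (f ∘ suc))

  sum-ifʳ : ∀ {n} (i : Fin n) (f : Fin n → Carrier) → sum (λ k → if does (k ≟ i) then f k else ε) ≈ f i
  sum-ifʳ {suc n} zero    f = trans (∙-congˡ (sum-zero {n} {f = λ _ → ε} λ _ → refl)) (identityʳ _)
  sum-ifʳ         (suc i) f = trans (identityˡ _) (sum-ifʳ i (f ∘ suc))

  sum-splitAt : ∀ {n m} (f : Fin n ⊎ Fin m → Carrier) →
                sum (λ k → f (splitAt n k)) ≈ sum (f ∘ inj₁) ∙ sum (f ∘ inj₂)
  sum-splitAt {zero}      f = sym (identityˡ _)
  sum-splitAt {suc n} {m} f =
    trans (∙-congˡ (sum-splitAt {n} {m} (f ∘ map₁ suc))) (sym (assoc _ _ _))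

  sum-joinVertex : ∀ {n m} (f : JoinVertex n m → Carrier) →
                   sum (λ k → f (joinVertex n m k)) ≈ sum (f ∘ u) ∙ (sum (f ∘ u′) ∙ sum (f ∘ v))
  sum-joinVertex {n} {m} f =
    trans (sum-splitAt {n} {n ℕ.+ m} (f ∘ [ u , [ u′ , v ]′ ∘ splitAt n ]′))
          (∙-congˡ (sum-splitAt {n} {m} (f ∘ [ u′ , v ]′)))

-- Ring solver with integer coefficients.

module IntegerSolver {c ℓ} (R : CommutativeRing c ℓ) where
  open CommutativeRing R
  open import Algebra.Properties.Ring ring
    using (-‿distribˡ-*; -‿distribʳ-*; -0#≈0#; -‿+-comm; -‿involutive)
  open import Algebra.Properties.Semiring.Mult semiring
    using (×-homo-+; ×1-homo-*; ×-homo-1) renaming (_×_ to _·_)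
  open import Algebra.Solver.Ring.AlmostCommutativeRing
  open import Relation.Binary.Reasoning.Setoid setoid
  import Algebra.Solver.Ring.NaturalCoefficients commutativeSemiring
    (λ m n → nothing) as S

  private
    ι : ℕ → Carrier
    ι n = n · 1#

    ⟦_⟧ : ℕ × ℕ → Carrier
    ⟦ a , b ⟧ = ι a - ι b

    -- The pair (a , b) stands for the integer a - b.
    differences : RawRing _ _
    differences = record
      { Carrier = ℕ × ℕ
      ; _≈_     = _≡_
      ; _+_     = λ { (a , b) (c , d) → a ℕ.+ c , b ℕ.+ d }
      ; _*_     = λ { (a , b) (c , d) → a ℕ.* c ℕ.+ b ℕ.* d , a ℕ.* d ℕ.+ b ℕ.* c }
      ; -_      = λ { (a , b) → b , a }
      ; 0#      = 0 , 0
      ; 1#      = 1 , 0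
      }

    +-interchange : ∀ w x y z → (w + x) + (y + z) ≈ (w + y) + (x + z)
    +-interchange = S.solve 4 (λ w x y z → (w S.:+ x) S.:+ (y S.:+ z) S.:= (w S.:+ y) S.:+ (x S.:+ z)) refl

    neg² : ∀ x y → - x * - y ≈ x * y
    neg² x y = begin
      - x * - y     ≈⟨ -‿distribˡ-* x (- y) ⟨
      - (x * - y)   ≈⟨ -‿cong (-‿distribʳ-* x y) ⟨
      - (- (x * y)) ≈⟨ -‿involutive _ ⟩
      x * y         ∎

    morphism : differences -Raw-AlmostCommutative⟶ fromCommutativeRing R
    morphism = record
      { ⟦_⟧    = ⟦_⟧
      ; +-homo = λ { (a , b) (c , d) → begin
          ι (a ℕ.+ c) - ι (b ℕ.+ d)
            ≈⟨ +-cong (×-homo-+ 1# a c) (-‿cong (×-homo-+ 1# b d)) ⟩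
          (ι a + ι c) - (ι b + ι d)
            ≈⟨ +-congˡ (sym (-‿+-comm _ _)) ⟩
          (ι a + ι c) + (- ι b - ι d)
            ≈⟨ +-interchange _ _ _ _ ⟩
          ⟦ a , b ⟧ + ⟦ c , d ⟧ ∎ }
      ; *-homo = λ { (a , b) (c , d) → begin
          ι (a ℕ.* c ℕ.+ b ℕ.* d) - ι (a ℕ.* d ℕ.+ b ℕ.* c)
            ≈⟨ +-cong (×-homo-+ 1# (a ℕ.* c) _) (-‿cong (×-homo-+ 1# (a ℕ.* d) _)) ⟩
          (ι (a ℕ.* c) + ι (b ℕ.* d)) - (ι (a ℕ.* d) + ι (b ℕ.* c))
            ≈⟨ +-cong (+-cong (×1-homo-* a c) (×1-homo-* b d))
                      (-‿cong (+-cong (×1-homo-* a d) (×1-homo-* b c))) ⟩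
          (ι a * ι c + ι b * ι d) - (ι a * ι d + ι b * ι c)
            ≈⟨ +-cong (+-congˡ (sym (neg² _ _)))
                 (trans (sym (-‿+-comm _ _)) (+-cong (-‿distribʳ-* _ _) (-‿distribˡ-* _ _))) ⟩
          (ι a * ι c + - ι b * - ι d) + (ι a * - ι d + - ι b * ι c)
            ≈⟨ S.solve 4 (λ p q r s →
                 (p S.:* r S.:+ q S.:* s) S.:+ (p S.:* s S.:+ q S.:* r)
                 S.:= (p S.:+ q) S.:* (r S.:+ s)) refl (ι a) (- ι b) (ι c) (- ι d) ⟩
          ⟦ a , b ⟧ * ⟦ c , d ⟧ ∎ }
      ; -‿homo = λ { (a , b) → begin
          ι b - ι a         ≈⟨ +-comm _ _ ⟩
          - ι a + ι b       ≈⟨ +-congˡ (-‿involutive _) ⟨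
          - ι a - - ι b     ≈⟨ -‿+-comm _ _ ⟩
          - (ι a - ι b)     ∎ }
      ; 0-homo = -‿inverseʳ 0#
      ; 1-homo = trans (+-cong (×-homo-1 1#) -0#≈0#) (+-identityʳ 1#)
      }

    -- Equality of the ring is not decidable, so equal coefficients are recognised on the pairs of
    -- naturals, by comparing `a + d` with `c + b`.
    ⟦⟧-cong : ∀ p q → Maybe (⟦ p ⟧ ≈ ⟦ q ⟧)
    ⟦⟧-cong (a , b) (c , d) with a ℕ.+ d ℕ.≟ c ℕ.+ b
    ... | no _   = nothing
    ... | yes eq = just (begin
        ι a - ι b                       ≈⟨ +-identityʳ _ ⟨
        (ι a - ι b) + 0#                ≈⟨ +-congˡ (-‿inverseʳ (ι d)) ⟨
        (ι a - ι b) + (ι d - ι d)       ≈⟨ +-interchange _ _ _ _ ⟩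
        (ι a + ι d) + (- ι b - ι d)     ≈⟨ +-congʳ a+d≈c+b ⟩
        (ι c + ι b) + (- ι b - ι d)     ≈⟨ +-congˡ (+-comm _ _) ⟩
        (ι c + ι b) + (- ι d - ι b)     ≈⟨ +-interchange _ _ _ _ ⟩
        (ι c - ι d) + (ι b - ι b)       ≈⟨ +-congˡ (-‿inverseʳ (ι b)) ⟩
        (ι c - ι d) + 0#                ≈⟨ +-identityʳ _ ⟩
        ι c - ι d                       ∎)
      where
      a+d≈c+b : ι a + ι d ≈ ι c + ι b
      a+d≈c+b = begin
        ι a + ι d     ≈⟨ ×-homo-+ 1# a d ⟨
        ι (a ℕ.+ d)   ≡⟨ ≡.cong ι eq ⟩
        ι (c ℕ.+ b)   ≈⟨ ×-homo-+ 1# c b ⟩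
        ι c + ι b     ∎

  open import Algebra.Solver.Ring differences (fromCommutativeRing R) morphism ⟦⟧-cong public
    using (solve; _:=_; _:+_; _:*_; _:-_; :-_; _:^_; con; Polynomial)

  -- A zeroth power evaluates to `1#` on the nose, whereas `con (1 , 0)` evaluates to
  -- `1 · 1# - 0 · 1#`.
  :1 : ∀ {n} → Polynomial n
  :1 = con (0 , 0) :^ 0

-- The determinant as the unique normalised alternating functional of rows.

module Determinant {c ℓ₁ ℓ₂} (K : AlgebraicallyClosedCharZeroField c ℓ₁ ℓ₂) where

  open AlgebraicallyClosedCharZeroField K using (commutativeRing)
  open CommutativeRing commutativeRing hiding (zero)
  open import Algebra.Properties.Semiring.Sum semiring
  open import Algebra.Properties.AbelianGroup +-abelianGroup using (inverseˡ-unique)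
  open import Algebra.Properties.Ring ring using (-0#≈0#)
  open import Algebra.Properties.Semiring.Exp semiring using (_^_)
  open import Relation.Binary.Reasoning.Setoid setoid
  open IntegerSolver commutativeRing
  open FiniteSum +-commutativeMonoid
  open Spectra K using (Matrix; det; diagonal)

  Row : ℕ → Set c
  Row p = Fin p → Carrier

  infix 4 _≋_ _≋₂_
  _≋_ : ∀ {p} → Row p → Row p → Set ℓ₁
  x ≋ y = ∀ j → x j ≈ y j

  _≋₂_ : ∀ {n p} → (Fin n → Row p) → (Fin n → Row p) → Set ℓ₁
  M ≋₂ N = ∀ i → M i ≋ N i

  comb : ∀ {p} → Carrier → Row p → Carrier → Row p → Row p
  comb a x b y j = a * x j + b * y j

  Linear : ∀ {p} → (Row p → Carrier) → Set (c ⊔ ℓ₁)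
  Linear f = ∀ a x b y → f (comb a x b y) ≈ a * f x + b * f y

  Congruent : ∀ {n p} → ((Fin n → Row p) → Carrier) → Set (c ⊔ ℓ₁)
  Congruent D = ∀ {M N} → M ≋₂ N → D M ≈ D N

  record RowMap p q : Set (c ⊔ ℓ₁) where
    field
      map    : Row p → Row q
      cong   : ∀ {x y} → x ≋ y → map x ≋ map y
      linear : ∀ a x b y → map (comb a x b y) ≋ comb a (map x) b (map y)
  open RowMap

  AlternatingHead : ∀ n {p} → ((Fin n → Row p) → Carrier) → Set (c ⊔ ℓ₁)
  AlternatingHead zero          D = ⊤
  AlternatingHead (suc zero)    D = ⊤
  AlternatingHead (suc (suc n)) D = ∀ x M → D (x ◂ x ◂ M) ≈ 0#

  -- Alternation is only required of the first two rows, for every way of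
  -- fixing the rows above them; that is, of adjacent rows.
  Alternating : ∀ n {p} → ((Fin n → Row p) → Carrier) → Set (c ⊔ ℓ₁)
  Alternating zero    D = Congruent D
  Alternating (suc n) D =
    Congruent D × (∀ M → Linear λ x → D (x ◂ M)) × AlternatingHead (suc n) D ×
    (∀ x → Alternating n λ M → D (x ◂ M))

  ◂-η : ∀ {n p} (M : Fin (suc n) → Row p) → head M ◂ tail M ≋₂ M
  ◂-η M zero    j = refl
  ◂-η M (suc i) j = refl

  ◂-cong : ∀ {n p} {x y : Row p} {M N : Fin n → Row p} → x ≋ y → M ≋₂ N → x ◂ M ≋₂ y ◂ N
  ◂-cong x≋y M≋N zero    = x≋y
  ◂-cong x≋y M≋N (suc i) = M≋N i

  ◂-congˡ : ∀ {n p} {x : Row p} {M N : Fin n → Row p} → M ≋₂ N → x ◂ M ≋₂ x ◂ N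
  ◂-congˡ = ◂-cong λ _ → refl

  alternating-congruent : ∀ {n p} {D : (Fin n → Row p) → Carrier} → Alternating n D → Congruent D
  alternating-congruent {zero}  alt = alt
  alternating-congruent {suc n} alt = proj₁ alt

  alternatingHead-resp : ∀ n {p} {D E : (Fin n → Row p) → Carrier} → (∀ M → E M ≈ D M) →
                         AlternatingHead n D → AlternatingHead n E
  alternatingHead-resp zero          E≈D alt = tt
  alternatingHead-resp (suc zero)    E≈D alt = tt
  alternatingHead-resp (suc (suc n)) E≈D alt x M = trans (E≈D _) (alt x M)

  alternating-resp : ∀ {n p} {D E : (Fin n → Row p) → Carrier} → (∀ M → E M ≈ D M) →
                     Alternating n D → Alternating n E
  alternating-resp {zero} E≈D cong-D M≋N = trans (E≈D _) (trans (cong-D M≋N) (sym (E≈D _)))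
  alternating-resp {suc n} E≈D (cong-D , linear-D , head-D , tail-D) =
    (λ M≋N → trans (E≈D _) (trans (cong-D M≋N) (sym (E≈D _)))) ,
    (λ M a x b y → trans (E≈D _) (trans (linear-D M a x b y)
       (+-cong (*-congˡ (sym (E≈D _))) (*-congˡ (sym (E≈D _)))))) ,
    alternatingHead-resp (suc n) E≈D head-D ,
    (λ x → alternating-resp (λ M → E≈D _) (tail-D x))

  -- Deleting a column, inserting a zero, padding with zeros and multiplying by a matrix on the
  -- right are all linear on rows; this lemma keeps the resulting functionals within reach of
  -- `alternating-unique`.
  alternating-map : ∀ {n p q} {D : (Fin n → Row q) → Carrier} (φ : RowMap p q) →
                    Alternating n D → Alternating n λ M → D (map φ ∘ M)
  alternating-map {zero} φ cong-D M≋N = cong-D λ i → cong φ (M≋N i)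
  alternating-map {suc n} {D = D} φ (cong-D , linear-D , head-D , tail-D) =
    (λ M≋N → cong-D λ i → cong φ (M≋N i)) ,
    (λ M a x b y → begin
      D (map φ ∘ (comb a x b y ◂ M))                      ≈⟨ cong-D (map-◂ _ M) ⟩
      D (map φ (comb a x b y) ◂ map φ ∘ M)                ≈⟨ cong-D (◂-cong (linear φ a x b y) λ _ _ → refl) ⟩
      D (comb a (map φ x) b (map φ y) ◂ map φ ∘ M)        ≈⟨ linear-D _ a _ b _ ⟩
      a * D (map φ x ◂ map φ ∘ M) + b * D (map φ y ◂ map φ ∘ M)
        ≈⟨ +-cong (*-congˡ (cong-D (map-◂ x M))) (*-congˡ (cong-D (map-◂ y M))) ⟨
      a * D (map φ ∘ (x ◂ M)) + b * D (map φ ∘ (y ◂ M))   ∎) ,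
    head-map n {D} {cong-D} head-D ,
    (λ x → alternating-resp (λ M → cong-D (map-◂ x M)) (alternating-map φ (tail-D (map φ x))))
    where
    map-◂ : ∀ {n} x (M : Fin n → Row _) → map φ ∘ (x ◂ M) ≋₂ map φ x ◂ map φ ∘ M
    map-◂ x M zero    j = refl
    map-◂ x M (suc i) j = refl

    map-◂₂ : ∀ {n} x y (M : Fin n → Row _) → map φ ∘ (x ◂ y ◂ M) ≋₂ map φ x ◂ map φ y ◂ map φ ∘ M
    map-◂₂ x y M zero          j = refl
    map-◂₂ x y M (suc zero)    j = refl
    map-◂₂ x y M (suc (suc i)) j = refl

    head-map : ∀ n {D : (Fin (suc n) → Row _) → Carrier} → {Congruent D} → AlternatingHead (suc n) D →
               AlternatingHead (suc n) λ M → D (map φ ∘ M)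
    head-map zero    h = tt
    head-map (suc n) {D} {cong-D} h x M = trans (cong-D (map-◂₂ x x M)) (h _ _)

  -- For the Laplace expansion: with its first row fixed, `det` is a linear combination of minors,
  -- each alternating in the remaining rows.
  alternating-sum : ∀ {n p m} (a : Row m) {D : Fin m → (Fin n → Row p) → Carrier} →
                    (∀ k → Alternating n (D k)) → Alternating n λ M → sum λ k → a k * D k M
  alternating-sum {zero} a alt M≋N = sum-cong-≋ λ k → *-congˡ (alt k M≋N)
  alternating-sum {suc n} {m = m} a {D} alt =
    (λ M≋N → sum-cong-≋ λ k → *-congˡ (proj₁ (alt k) M≋N)) ,
    (λ M s x t y → begin
      sum (λ k → a k * D k (comb s x t y ◂ M))
        ≈⟨ sum-cong-≋ (λ k → *-congˡ (proj₁ (proj₂ (alt k)) M s x t y)) ⟩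
      sum (λ k → a k * (s * D k (x ◂ M) + t * D k (y ◂ M)))
        ≈⟨ sum-cong-≋ (λ k → solve 5 (λ a s x t y → a :* (s :* x :+ t :* y) := s :* (a :* x) :+ t :* (a :* y))
             refl (a k) s _ t _) ⟩
      sum (λ k → s * (a k * D k (x ◂ M)) + t * (a k * D k (y ◂ M)))
        ≈⟨ ∑-distrib-+ (λ k → s * (a k * D k (x ◂ M))) (λ k → t * (a k * D k (y ◂ M))) ⟩
      sum (λ k → s * (a k * D k (x ◂ M))) + sum (λ k → t * (a k * D k (y ◂ M)))
        ≈⟨ +-cong (*-distribˡ-sum {m} s _) (*-distribˡ-sum {m} t _) ⟨
      s * sum (λ k → a k * D k (x ◂ M)) + t * sum (λ k → a k * D k (y ◂ M)) ∎) ,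
    head-sum n (λ k → proj₁ (proj₂ (proj₂ (alt k)))) ,
    (λ x → alternating-sum a (λ k → proj₂ (proj₂ (proj₂ (alt k))) x))
    where
    head-sum : ∀ n {D : Fin _ → (Fin (suc n) → Row _) → Carrier} →
               (∀ k → AlternatingHead (suc n) (D k)) →
               AlternatingHead (suc n) λ M → sum λ k → a k * D k M
    head-sum zero    h = tt
    head-sum (suc n) h x M =
      trans (sum-cong-≋ λ k → trans (*-congˡ (h k x M)) (zeroʳ _)) (sum-replicate-zero m)

  -- Freezes the last `m` rows, so that `alternating-unique` can act on a group of rows inside a
  -- larger determinant.
  alternating-++ : ∀ {n m p} {D : (Fin (n ℕ.+ m) → Row p) → Carrier} (N : Fin m → Row p) →
                   Alternating (n ℕ.+ m) D → Alternating n λ M → D (M ++ N)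
  alternating-++ {zero} N alt M≋N = alternating-congruent alt λ _ _ → refl
  alternating-++ {suc n} {D = D} N (cong-D , linear-D , head-D , tail-D) =
    (λ M≋M′ → cong-D (++-congʳ M≋M′)) ,
    (λ M a x b y → trans (cong-D (◂-++ _ M)) (trans (linear-D _ a x b y)
       (sym (+-cong (*-congˡ (cong-D (◂-++ x M))) (*-congˡ (cong-D (◂-++ y M))))))) ,
    head-++ n {D = D} cong-D head-D ,
    (λ x → alternating-resp (λ M → cong-D (◂-++ x M)) (alternating-++ N (tail-D x)))
    where
    ++-congʳ : ∀ {n} {M M′ : Fin n → Row _} → M ≋₂ M′ → (M ++ N) ≋₂ (M′ ++ N)
    ++-congʳ {n} M≋M′ i j with splitAt n i
    ... | inj₁ i′ = M≋M′ i′ j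
    ... | inj₂ _  = refl

    ◂-++ : ∀ {n} x (M : Fin n → Row _) → ((x ◂ M) ++ N) ≋₂ x ◂ (M ++ N)
    ◂-++ x M zero    j = refl
    ◂-++ {n} x M (suc i) j with splitAt n i
    ... | inj₁ _ = refl
    ... | inj₂ _ = refl

    head-++ : ∀ n {D : (Fin (suc n ℕ.+ _) → Row _) → Carrier} → Congruent D →
              AlternatingHead (suc n ℕ.+ _) D → AlternatingHead (suc n) λ M → D (M ++ N)
    head-++ zero    cong-D h = tt
    head-++ (suc n) cong-D h x M = trans (cong-D λ i j → trans (◂-++ x (x ◂ M) i j) (◂-congˡ (◂-++ x M) i j)) (h x (M ++ N))

  𝟙 : ∀ {n} → Matrix n
  𝟙 = diagonal λ _ → 1#

  sum-diagonalˡ : ∀ {n} (d : Row n) i (f : Row n) → sum (λ k → diagonal d i k * f k) ≈ d i * f i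
  sum-diagonalˡ d i f = trans (sum-cong-≋ λ k → if-* (does (i ≟ k)) k) (sum-ifˡ i λ k → d i * f k)
    where
    if-* : ∀ b k → (if b then d i else 0#) * f k ≈ (if b then d i * f k else 0#)
    if-* true  k = refl
    if-* false k = zeroˡ _

  sum-diagonalʳ : ∀ {n} (d : Row n) i (f : Row n) → sum (λ k → f k * diagonal d k i) ≈ f i * d i
  sum-diagonalʳ d i f = trans (sum-cong-≋ λ k → *-if (does (k ≟ i)) k) (sum-ifʳ i λ k → f k * d k)
    where
    *-if : ∀ b k → f k * (if b then d k else 0#) ≈ (if b then f k * d k else 0#)
    *-if true  k = refl
    *-if false k = zeroʳ _

  linear-sum : ∀ {n p} {f : Row p → Carrier} → (∀ {x y} → x ≋ y → f x ≈ f y) → Linear f →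
               (a : Row n) (X : Fin n → Row p) →
               f (λ j → sum λ k → a k * X k j) ≈ sum λ k → a k * f (X k)
  linear-sum {zero} {f = f} cong-f linear-f a X = begin
    f (λ _ → 0#)                        ≈⟨ cong-f (λ _ → comb-zero) ⟨
    f (comb 0# (λ _ → 0#) 0# λ _ → 0#)  ≈⟨ linear-f 0# _ 0# _ ⟩
    0# * f _ + 0# * f _                 ≈⟨ comb-zero ⟩
    0#                                  ∎
    where
    comb-zero : ∀ {a b} → 0# * a + 0# * b ≈ 0#
    comb-zero = trans (+-cong (zeroˡ _) (zeroˡ _)) (+-identityˡ _)
  linear-sum {suc n} {f = f} cong-f linear-f a X = begin
    f (λ j → a zero * X zero j + rest j)          ≈⟨ cong-f (λ j → +-congˡ (*-identityˡ _)) ⟨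
    f (comb (a zero) (X zero) 1# rest)            ≈⟨ linear-f _ _ _ _ ⟩
    a zero * f (X zero) + 1# * f rest             ≈⟨ +-congˡ (*-identityˡ _) ⟩
    a zero * f (X zero) + f rest
      ≈⟨ +-congˡ (linear-sum {f = f} cong-f linear-f (a ∘ suc) (X ∘ suc)) ⟩
    a zero * f (X zero) + sum (λ k → a (suc k) * f (X (suc k))) ∎
    where
    rest : Row _
    rest j = sum λ k → a (suc k) * X (suc k) j

  module _ {n p} {D : (Fin (suc n) → Row p) → Carrier} (alt : Alternating (suc n) D) where

    private
      cong-D : Congruent D
      cong-D = proj₁ alt

    linear-head : ∀ M → Linear λ x → D (x ◂ M)
    linear-head = proj₁ (proj₂ alt)

    alternating-tail : ∀ x → Alternating n λ M → D (x ◂ M)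
    alternating-tail = proj₂ (proj₂ (proj₂ alt))

    expand-head : ∀ M → D M ≈ sum λ k → M zero k * D (𝟙 k ◂ tail M)
    expand-head M = begin
      D M                                               ≈⟨ cong-D (◂-η M) ⟨
      D (M zero ◂ tail M)
        ≈⟨ cong-D (◂-cong (λ j → trans (sum-diagonalʳ (λ _ → 1#) j (M zero)) (*-identityʳ _)) λ _ _ → refl) ⟨
      D ((λ j → sum λ k → M zero k * 𝟙 k j) ◂ tail M)
        ≈⟨ linear-sum (λ x≋y → cong-D (◂-cong x≋y λ _ _ → refl)) (linear-head (tail M)) (M zero) 𝟙 ⟩
      sum (λ k → M zero k * D (𝟙 k ◂ tail M))           ∎

  -- `D` vanishes when both top rows are `x + y`; after expansion in both rows only the two mixed
  -- terms survive.
  alternating-swap : ∀ {n p} {D : (Fin (suc (suc n)) → Row p) → Carrier} → Alternating (suc (suc n)) D →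
                     ∀ x y M → D (x ◂ y ◂ M) ≈ - D (y ◂ x ◂ M)
  alternating-swap {D = D} alt x y M = inverseˡ-unique _ _ (begin
    f x y + f y x
      ≈⟨ solve 2 (λ s t → s :+ t := :1 :* s :+ :1 :* t) refl _ _ ⟩
    1# * f x y + 1# * f y x
      ≈⟨ +-cong (*-congˡ (trans (second x) (trans (+-congʳ (proj₁ (proj₂ (proj₂ alt)) x M)) (+-identityˡ _))))
                (*-congˡ (trans (second y) (trans (+-congˡ (proj₁ (proj₂ (proj₂ alt)) y M)) (+-identityʳ _)))) ⟨
    1# * f x x+y + 1# * f y x+y   ≈⟨ linear-head alt _ 1# x 1# y ⟨
    f x+y x+y                     ≈⟨ proj₁ (proj₂ (proj₂ alt)) x+y M ⟩
    0#                            ∎)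
    where
    f : Row _ → Row _ → Carrier
    f x y = D (x ◂ y ◂ M)
    x+y : Row _
    x+y = comb 1# x 1# y
    second : ∀ z → f z x+y ≈ f z x + f z y
    second z = trans (linear-head (alternating-tail alt z) M 1# x 1# y)
                     (+-cong (*-identityˡ _) (*-identityˡ _))

  -- Swaps of adjacent rows carry `x` down until it meets its copy.
  alternating-repeat : ∀ {n p} {D : (Fin (suc n) → Row p) → Carrier} → Alternating (suc n) D →
                       ∀ i x M → M i ≋ x → D (x ◂ M) ≈ 0#
  alternating-repeat {suc n} {D = D} alt zero x M M₀≋x = begin
    D (x ◂ M)            ≈⟨ proj₁ alt (◂-congˡ (◂-η M)) ⟨
    D (x ◂ M zero ◂ tail M) ≈⟨ proj₁ alt (◂-congˡ (◂-cong M₀≋x λ _ _ → refl)) ⟩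
    D (x ◂ x ◂ tail M)   ≈⟨ proj₁ (proj₂ (proj₂ alt)) x (tail M) ⟩
    0#                   ∎
  alternating-repeat {suc n} {D = D} alt (suc i) x M Mᵢ≋x = begin
    D (x ◂ M)                 ≈⟨ proj₁ alt (◂-congˡ (◂-η M)) ⟨
    D (x ◂ M zero ◂ tail M)   ≈⟨ alternating-swap alt x (M zero) (tail M) ⟩
    - D (M zero ◂ x ◂ tail M)
      ≈⟨ -‿cong (alternating-repeat (alternating-tail alt (M zero)) i x (tail M) Mᵢ≋x) ⟩
    - 0#                      ≈⟨ -0#≈0# ⟩
    0#                        ∎

  -- By linearity, a multiple of `e` inside a row contributes a multiple of the value of `D` with
  -- `e` as that row, which `vanish` makes zero. It serves to clear column `k` below a top row
  -- `𝟙 k`.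
  alternating-shift : ∀ {n p} {D : (Fin n → Row p) → Carrier} → Alternating n D →
                      ∀ e → (∀ i M → M i ≋ e → D M ≈ 0#) →
                      ∀ (a : Row n) M N → (∀ i → M i ≋ comb 1# (N i) (a i) e) → D M ≈ D N
  alternating-shift {zero}  alt e vanish a M N M≋ = alt λ ()
  alternating-shift {suc n} {D = D} alt e vanish a M N M≋ = begin
    D M                                                 ≈⟨ proj₁ alt (◂-η M) ⟨
    D (M zero ◂ tail M)                                 ≈⟨ proj₁ alt (◂-cong (M≋ zero) λ _ _ → refl) ⟩
    D (comb 1# (N zero) (a zero) e ◂ tail M)            ≈⟨ linear-head alt _ _ _ _ _ ⟩
    1# * D (N zero ◂ tail M) + a zero * D (e ◂ tail M)
      ≈⟨ +-cong (*-identityˡ _) (trans (*-congˡ (vanish zero _ λ _ → refl)) (zeroʳ _)) ⟩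
    D (N zero ◂ tail M) + 0#                            ≈⟨ +-identityʳ _ ⟩
    D (N zero ◂ tail M)
      ≈⟨ alternating-shift (alternating-tail alt (N zero)) e (λ i M → vanish (suc i) (N zero ◂ M))
           (a ∘ suc) (tail M) (tail N) (M≋ ∘ suc) ⟩
    D (N zero ◂ tail N)                                 ≈⟨ proj₁ alt (◂-η N) ⟩
    D N                                                 ∎

  -- Row `k` reaches the top by passing the `k` rows above it, with one change of sign each.
  alternating-rotate : ∀ {n p} {D : (Fin (suc n) → Row p) → Carrier} → Alternating (suc n) D →
                       ∀ k M → D (M k ◂ M ∘ punchIn k) ≈ (- 1#) ^ toℕ k * D M
  alternating-rotate {D = D} alt zero M = begin
    D (M zero ◂ tail M)   ≈⟨ proj₁ alt (◂-η M) ⟩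
    D M                   ≈⟨ *-identityˡ _ ⟨
    1# * D M              ∎
  alternating-rotate {suc n} {D = D} alt (suc k) M = begin
    D (M (suc k) ◂ M ∘ punchIn (suc k))                    ≈⟨ proj₁ alt (◂-congˡ (◂-η _)) ⟨
    D (M (suc k) ◂ M zero ◂ tail M ∘ punchIn k)            ≈⟨ alternating-swap alt _ _ _ ⟩
    - D (M zero ◂ M (suc k) ◂ tail M ∘ punchIn k)
      ≈⟨ -‿cong (alternating-rotate (alternating-tail alt (M zero)) k (tail M)) ⟩
    - ((- 1#) ^ toℕ k * D (M zero ◂ tail M))               ≈⟨ -‿cong (*-congˡ (proj₁ alt (◂-η M))) ⟩
    - ((- 1#) ^ toℕ k * D M)
      ≈⟨ solve 2 (λ s d → :- (s :* d) := ((:- :1) :* s) :* d) refl _ _ ⟩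
    (- 1#) ^ toℕ (suc k) * D M                             ∎

  -- Turns rows of a minor into full rows with a zero in column `k`; pulling back along it makes a
  -- functional of full rows one of the minor.
  insertRow : ∀ {n} → Fin (suc n) → RowMap n (suc n)
  insertRow k = record
    { map    = λ x → insertAt x k 0#
    ; cong   = insert-cong k
    ; linear = λ a x b y → insert-linear k a x b y
    }
    where
    insert-cong : ∀ {n} (k : Fin (suc n)) {x y : Row n} → x ≋ y → insertAt x k 0# ≋ insertAt y k 0#
    insert-cong zero x≋y zero    = refl
    insert-cong zero x≋y (suc j) = x≋y j
    insert-cong {suc n} (suc k) x≋y zero    = x≋y zero
    insert-cong {suc n} (suc k) x≋y (suc j) = insert-cong k (x≋y ∘ suc) j

    insert-linear : ∀ {n} (k : Fin (suc n)) a (x : Row n) b y →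
                    insertAt (comb a x b y) k 0# ≋ comb a (insertAt x k 0#) b (insertAt y k 0#)
    insert-linear zero a x b y zero    = sym (trans (+-cong (zeroʳ _) (zeroʳ _)) (+-identityˡ _))
    insert-linear zero a x b y (suc j) = refl
    insert-linear {suc n} (suc k) a x b y zero    = refl
    insert-linear {suc n} (suc k) a x b y (suc j) = insert-linear k a (tail x) b (tail y) j

  removeColumn : ∀ {n} → Fin (suc n) → RowMap (suc n) n
  removeColumn k = record
    { map    = λ x → removeAt x k
    ; cong   = λ x≋y j → x≋y (punchIn k j)
    ; linear = λ _ _ _ _ _ → refl
    }

  insertRow-𝟙 : ∀ {n} (k : Fin (suc n)) i → insertAt (𝟙 {n} i) k 0# ≋ 𝟙 (punchIn k i)
  insertRow-𝟙 zero    i       zero    = refl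
  insertRow-𝟙 zero    i       (suc j) = refl
  insertRow-𝟙 (suc k) zero    zero    = refl
  insertRow-𝟙 (suc k) (suc i) zero    = refl
  insertRow-𝟙 {suc n} (suc k) zero    (suc j) = insert-zero k j
    where
    insert-zero : ∀ {n} (k : Fin (suc n)) j → insertAt (λ (_ : Fin n) → 0#) k 0# j ≈ 0#
    insert-zero zero    zero    = refl
    insert-zero zero    (suc j) = refl
    insert-zero {suc n} (suc k) zero    = refl
    insert-zero {suc n} (suc k) (suc j) = insert-zero k j
  insertRow-𝟙 {suc n} (suc k) (suc i) (suc j) = insertRow-𝟙 k i j

  insert-remove : ∀ {n} (k : Fin (suc n)) x → x ≋ comb 1# (insertAt (removeAt x k) k 0#) (x k) (𝟙 k)
  insert-remove zero x zero    = sym (trans (+-cong (zeroʳ _) (*-identityʳ _)) (+-identityˡ _))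
  insert-remove zero x (suc j) = sym (trans (+-cong (*-identityˡ _) (zeroʳ _)) (+-identityʳ _))
  insert-remove {suc n} (suc k) x zero    = sym (trans (+-cong (*-identityˡ _) (zeroʳ _)) (+-identityʳ _))
  insert-remove {suc n} (suc k) x (suc j) = insert-remove k (x ∘ suc) j

  -- Expand the first row of D in unit vectors; each coefficient is again an
  -- alternating functional, of the minor.
  alternating-unique : ∀ {n} {D : Matrix n → Carrier} → Alternating n D → ∀ M → D M ≈ det M * D 𝟙
  alternating-unique {zero} alt M = trans (alt λ ()) (sym (*-identityˡ _))
  alternating-unique {suc n} {D} alt M = begin
    D M
      ≈⟨ expand-head alt M ⟩
    sum (λ k → M zero k * D (𝟙 k ◂ tail M))
      ≈⟨ sum-cong-≋ (λ k → trans (*-congˡ (cofactor k))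
           (solve 4 (λ a s d e → a :* (d :* (s :* e)) := ((s :* a) :* d) :* e) refl (M zero k) (sign k) _ _)) ⟩
    sum (λ k → sign k * M zero k * det (minor k) * D 𝟙)
      ≈⟨ *-distribʳ-sum {suc n} (D 𝟙) (λ k → sign k * M zero k * det (minor k)) ⟨
    det M * D 𝟙 ∎
    where
    sign : Fin (suc n) → Carrier
    sign k = (- 1#) ^ toℕ k

    minor : Fin (suc n) → Matrix n
    minor k i = removeAt (M (suc i)) k

    -- With `𝟙 k` on top, multiples of it can be removed from the rows below until column `k` is
    -- clear. The induction hypothesis then applies to the minor, and the value at the identity is
    -- `D 𝟙` with row `k` moved to the top.
    cofactor : ∀ k → D (𝟙 k ◂ tail M) ≈ det (minor k) * (sign k * D 𝟙)
    cofactor k = begin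
      D (𝟙 k ◂ tail M)
        ≈⟨ alternating-shift alt-k (𝟙 k) (λ i N Nᵢ≋ → alternating-repeat alt i (𝟙 k) N Nᵢ≋)
             (λ i → M (suc i) k) (tail M) _ (λ i → insert-remove k (M (suc i))) ⟩
      D (𝟙 k ◂ map (insertRow k) ∘ minor k)
        ≈⟨ alternating-unique (alternating-map (insertRow k) alt-k) (minor k) ⟩
      det (minor k) * D (𝟙 k ◂ map (insertRow k) ∘ 𝟙)
        ≈⟨ *-congˡ (proj₁ alt (◂-congˡ (insertRow-𝟙 k))) ⟩
      det (minor k) * D (𝟙 k ◂ 𝟙 ∘ punchIn k)
        ≈⟨ *-congˡ (alternating-rotate alt k 𝟙) ⟩
      det (minor k) * (sign k * D 𝟙) ∎
      where
      alt-k : Alternating n λ N → D (𝟙 k ◂ N)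
      alt-k = alternating-tail alt (𝟙 k)

  -- The pair `k`, `l` encodes the ordered pair of distinct indices `k` and `punchIn k l`. For
  -- `i ≤ j` the codes `inject₁ i , j` and `suc j , i` are the two orders of one pair, so the sum
  -- cancels pairwise; the induction first strips off the pairs that contain `zero`.
  sum-antisymmetric : ∀ {n} (h : Fin (suc n) → Row n) →
                      (∀ i j → i ≤ j → h (inject₁ i) j + h (suc j) i ≈ 0#) → sum (λ k → sum (h k)) ≈ 0#
  sum-antisymmetric {zero}  h anti = +-identityˡ 0#
  sum-antisymmetric {suc n} h anti = begin
    sum (h zero) + sum (λ k → h (suc k) zero + sum (λ l → h (suc k) (suc l)))
      ≈⟨ +-congˡ (∑-distrib-+ (λ k → h (suc k) zero) λ k → sum (λ l → h (suc k) (suc l))) ⟩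
    sum (h zero) + (sum (λ k → h (suc k) zero) + sum (λ k → sum (λ l → h (suc k) (suc l))))
      ≈⟨ +-congˡ (+-congˡ (sum-antisymmetric (λ k l → h (suc k) (suc l)) λ i j i≤j → anti (suc i) (suc j) (s≤s i≤j))) ⟩
    sum (h zero) + (sum (λ k → h (suc k) zero) + 0#)
      ≈⟨ +-congˡ (+-identityʳ _) ⟩
    sum (h zero) + sum (λ k → h (suc k) zero)
      ≈⟨ ∑-distrib-+ (h zero) (λ k → h (suc k) zero) ⟨
    sum (λ k → h zero k + h (suc k) zero)
      ≈⟨ sum-zero (λ k → anti zero k z≤n) ⟩
    0# ∎

  punchIn-inject₁ : ∀ {n} (i j : Fin n) → i ≤ j → punchIn (inject₁ i) j ≡ suc j
  punchIn-inject₁ zero    j       i≤j       = ≡.refl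
  punchIn-inject₁ (suc i) (suc j) (s≤s i≤j) = ≡.cong suc (punchIn-inject₁ i j i≤j)

  punchIn-suc : ∀ {n} (i j : Fin n) → i ≤ j → punchIn (suc j) i ≡ inject₁ i
  punchIn-suc zero    j       i≤j       = ≡.refl
  punchIn-suc (suc i) (suc j) (s≤s i≤j) = ≡.cong suc (punchIn-suc i j i≤j)

  -- Two columns removed in either order leave the same columns behind; this identifies the double
  -- minors that are paired in `det-repeat`.
  punchIn-comm : ∀ {n} (i j : Fin (suc n)) (l : Fin n) → i ≤ j →
                 punchIn (inject₁ i) (punchIn j l) ≡ punchIn (suc j) (punchIn i l)
  punchIn-comm zero    j       l       i≤j       = ≡.refl
  punchIn-comm (suc i) (suc j) zero    (s≤s i≤j) = ≡.refl
  punchIn-comm (suc i) (suc j) (suc l) (s≤s i≤j) = ≡.cong suc (punchIn-comm i j l i≤j)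

  det-cong : ∀ {n} {M N : Matrix n} → M ≋₂ N → det M ≈ det N
  det-cong {zero}  M≋N = refl
  det-cong {suc n} {M} M≋N = sum-cong-≋ {suc n} λ k →
    *-cong (*-congˡ {(- 1#) ^ toℕ k} (M≋N zero k)) (det-cong λ i j → M≋N (suc i) (punchIn k j))

  -- Expand along both equal rows. The terms for an ordered pair of columns and for its reversal
  -- have the same entries and the same double minor, but opposite signs: the larger column is
  -- counted one lower once the smaller is gone.
  det-repeat : ∀ {n} x (M : Fin n → Row (suc (suc n))) → det (x ◂ x ◂ M) ≈ 0#
  det-repeat {n} x M = begin
    sum (λ k → sign k * x k * sum (λ l → sign l * x (punchIn k l) * d k l))
      ≈⟨ sum-cong-≋ (λ k → *-distribˡ-sum {suc n} (sign k * x k) λ l → sign l * x (punchIn k l) * d k l) ⟩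
    sum (λ k → sum λ l → h k l)
      ≈⟨ sum-antisymmetric h anti ⟩
    0# ∎
    where
    sign : ∀ {n} → Fin n → Carrier
    sign k = (- 1#) ^ toℕ k

    d : Fin (suc (suc n)) → Fin (suc n) → Carrier
    d k l = det λ i j → M i (punchIn k (punchIn l j))

    h : Fin (suc (suc n)) → Fin (suc n) → Carrier
    h k l = sign k * x k * (sign l * x (punchIn k l) * d k l)

    anti : ∀ i j → i ≤ j → h (inject₁ i) j + h (suc j) i ≈ 0#
    anti i j i≤j = begin
      h (inject₁ i) j + h (suc j) i
        ≈⟨ +-cong (*-cong (*-congʳ (reflexive (≡.cong ((- 1#) ^_) (toℕ-inject₁ i))))
                          (*-cong (*-congˡ (reflexive (≡.cong x (punchIn-inject₁ i j i≤j))))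
                                  (det-cong λ a b → reflexive (≡.cong (M a) (punchIn-comm i j b i≤j)))))
                  (*-congˡ (*-congʳ (*-congˡ (reflexive (≡.cong x (punchIn-suc i j i≤j)))))) ⟩
      sign i * x (inject₁ i) * (sign j * x (suc j) * d (suc j) i) +
      - 1# * sign j * x (suc j) * (sign i * x (inject₁ i) * d (suc j) i)
        ≈⟨ +-congˡ (solve 5 (λ s t a b e → (:- :1) :* t :* b :* (s :* a :* e) := :- (s :* a :* (t :* b :* e)))
             refl (sign i) (sign j) _ _ _) ⟩
      sign i * x (inject₁ i) * (sign j * x (suc j) * d (suc j) i) -
      sign i * x (inject₁ i) * (sign j * x (suc j) * d (suc j) i)
        ≈⟨ -‿inverseʳ _ ⟩
      0# ∎

  -- Linearity in the first row is visible in the expansion. The other rows enter only through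
  -- minors, which alternate by induction after a column has been removed.
  det-alternating : ∀ {n} → Alternating n (det {n})
  det-alternating {zero}  M≋N = refl
  det-alternating {suc n} =
    det-cong ,
    (λ M a x b y → begin
      sum (λ k → sign k * (a * x k + b * y k) * minor M k)
        ≈⟨ sum-cong-≋ {suc n} (λ k → solve 6 (λ s a x b y d → s :* (a :* x :+ b :* y) :* d
             := a :* (s :* x :* d) :+ b :* (s :* y :* d)) refl (sign k) a (x k) b (y k) (minor M k)) ⟩
      sum (λ k → a * (sign k * x k * minor M k) + b * (sign k * y k * minor M k))
        ≈⟨ ∑-distrib-+ (λ k → a * (sign k * x k * minor M k)) (λ k → b * (sign k * y k * minor M k)) ⟩
      sum (λ k → a * (sign k * x k * minor M k)) + sum (λ k → b * (sign k * y k * minor M k))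
        ≈⟨ +-cong (*-distribˡ-sum {suc n} a λ k → sign k * x k * minor M k)
                  (*-distribˡ-sum {suc n} b λ k → sign k * y k * minor M k) ⟨
      a * det (x ◂ M) + b * det (y ◂ M) ∎) ,
    head-det n ,
    (λ x → alternating-sum (λ k → sign k * x k) λ k → alternating-map (removeColumn k) det-alternating)
    where
    sign : Fin (suc n) → Carrier
    sign k = (- 1#) ^ toℕ k

    minor : (Fin n → Row (suc n)) → Fin (suc n) → Carrier
    minor M k = det λ i → removeAt (M i) k

    head-det : ∀ n → AlternatingHead (suc n) (det {suc n})
    head-det zero    = tt
    head-det (suc n) = det-repeat

  infixl 7 _⊗_
  _⊗_ : ∀ {n} → Matrix n → Matrix n → Matrix n
  (M ⊗ N) i j = sum λ k → M i k * N k j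

  -- Right multiplication by `N` is linear on rows, so the left side is an alternating functional of
  -- `M`; its value at the identity is `det N`.
  det-⊗ : ∀ {n} (M N : Matrix n) → det (M ⊗ N) ≈ det M * det N
  det-⊗ {n} M N = begin
    det (M ⊗ N)           ≈⟨ alternating-unique (alternating-map right-mult det-alternating) M ⟩
    det M * det (𝟙 ⊗ N)   ≈⟨ *-congˡ (det-cong {M = 𝟙 ⊗ N} {N} λ i j →
                               trans (sum-diagonalˡ (λ _ → 1#) i λ k → N k j) (*-identityˡ _)) ⟩
    det M * det N         ∎
    where
    right-mult : RowMap n n
    right-mult = record
      { map    = λ x j → sum λ k → x k * N k j
      ; cong   = λ x≋y j → sum-cong-≋ λ k → *-congʳ (x≋y k)
      ; linear = λ a x b y j → begin
          sum (λ k → (a * x k + b * y k) * N k j)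
            ≈⟨ sum-cong-≋ {n} (λ k → solve 5 (λ a x b y z → (a :* x :+ b :* y) :* z := a :* (x :* z) :+ b :* (y :* z))
                 refl a (x k) b (y k) (N k j)) ⟩
          sum (λ k → a * (x k * N k j) + b * (y k * N k j))
            ≈⟨ ∑-distrib-+ (λ k → a * (x k * N k j)) (λ k → b * (y k * N k j)) ⟩
          sum (λ k → a * (x k * N k j)) + sum (λ k → b * (y k * N k j))
            ≈⟨ +-cong (*-distribˡ-sum {n} a _) (*-distribˡ-sum {n} b _) ⟨
          a * sum (λ k → x k * N k j) + b * sum (λ k → y k * N k j) ∎
      }

-- Triangular blocks, bordering, and splitting off a block of rows.

module Block {c ℓ₁ ℓ₂} (K : AlgebraicallyClosedCharZeroField c ℓ₁ ℓ₂) where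

  open Determinant K
  open AlgebraicallyClosedCharZeroField K using (commutativeRing)
  open CommutativeRing commutativeRing hiding (zero)
  open import Algebra.Properties.Semiring.Sum semiring
  open import Algebra.Properties.Semiring.Exp semiring using (_^_)
  open import Relation.Binary.Reasoning.Setoid setoid
  open IntegerSolver commutativeRing
  open FiniteSum +-commutativeMonoid
  open Spectra K using (Matrix; det; diagonal)

  tail-minor : ∀ {n} → Matrix (suc n) → Matrix n
  tail-minor M i j = M (suc i) (suc j)

  -- Asking for vanishing products covers both uses: entries that vanish in `det-headRow`, minors
  -- that vanish in `det-zeroColumn` and `det-headColumn`.
  det-head : ∀ {n} (M : Matrix (suc n)) →
             (∀ k → M zero (suc k) * det (λ i j → M (suc i) (punchIn (suc k) j)) ≈ 0#) →
             det M ≈ M zero zero * det (tail-minor M)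
  det-head {n} M cofactor≈0 = begin
    1# * M zero zero * det (tail-minor M) + sum (λ k → sign k * M zero (suc k) * minor k)
      ≈⟨ +-cong (*-congʳ (*-identityˡ _)) (sum-zero {n} λ k →
           trans (*-assoc (sign k) _ _) (trans (*-congˡ (cofactor≈0 k)) (zeroʳ _))) ⟩
    M zero zero * det (tail-minor M) + 0#
      ≈⟨ +-identityʳ _ ⟩
    M zero zero * det (tail-minor M) ∎
    where
    sign minor : Fin n → Carrier
    sign k = (- 1#) ^ toℕ (suc k)
    minor k = det λ i j → M (suc i) (punchIn (suc k) j)

  -- The minors away from the corner keep column zero, so they vanish by induction.
  det-zeroColumn : ∀ {n} (M : Matrix (suc n)) → (∀ i → M i zero ≈ 0#) → det M ≈ 0#
  det-zeroColumn {n} M col≈0 = trans (det-head M (cofactor M col≈0)) (trans (*-congʳ (col≈0 zero)) (zeroˡ _))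
    where
    cofactor : ∀ {n} (M : Matrix (suc n)) → (∀ i → M i zero ≈ 0#) → (k : Fin n) →
               M zero (suc k) * det (λ i j → M (suc i) (punchIn (suc k) j)) ≈ 0#
    cofactor {suc n} M col≈0 k =
      trans (*-congˡ (det-zeroColumn (λ i j → M (suc i) (punchIn (suc k) j)) (col≈0 ∘ suc))) (zeroʳ _)

  det-headRow : ∀ {n} (M : Matrix (suc n)) → (∀ j → M zero (suc j) ≈ 0#) →
                det M ≈ M zero zero * det (tail-minor M)
  det-headRow M row≈0 = det-head M λ k → trans (*-congʳ (row≈0 k)) (zeroˡ _)

  det-headColumn : ∀ {n} (M : Matrix (suc n)) → (∀ i → M (suc i) zero ≈ 0#) →
                   det M ≈ M zero zero * det (tail-minor M)
  det-headColumn M col≈0 = det-head M (cofactor M col≈0)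
    where
    cofactor : ∀ {n} (M : Matrix (suc n)) → (∀ i → M (suc i) zero ≈ 0#) → (k : Fin n) →
               M zero (suc k) * det (λ i j → M (suc i) (punchIn (suc k) j)) ≈ 0#
    cofactor {suc n} M col≈0 k =
      trans (*-congˡ (det-zeroColumn (λ i j → M (suc i) (punchIn (suc k) j)) col≈0)) (zeroʳ _)

  det-𝟙 : ∀ {n} → det (𝟙 {n}) ≈ 1#
  det-𝟙 {zero}  = refl
  det-𝟙 {suc n} = trans (det-headRow (𝟙 {suc n}) λ _ → refl) (trans (*-identityˡ _) (det-𝟙 {n}))

  block : ∀ {n m} → (Fin n → Row n) → (Fin n → Row m) → (Fin m → Row n) → (Fin m → Row m) →
          Fin n ⊎ Fin m → Fin n ⊎ Fin m → Carrier
  block P U R S (inj₁ i) (inj₁ j) = P i j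
  block P U R S (inj₁ i) (inj₂ j) = U i j
  block P U R S (inj₂ i) (inj₁ j) = R i j
  block P U R S (inj₂ i) (inj₂ j) = S i j

  scalar : ∀ {n} → Carrier → Matrix n
  scalar d = diagonal λ _ → d

  det-lowerBlock : ∀ {n m} d (R : Fin m → Row n) (S : Matrix m) →
                   det (λ i j → block (scalar d) (λ _ _ → 0#) R S (splitAt n i) (splitAt n j)) ≈ d ^ n * det S
  det-lowerBlock {zero}      d R S = sym (*-identityˡ _)
  det-lowerBlock {suc n} {m} d R S = begin
    det B                          ≈⟨ det-headRow B (λ j → row≈0 (splitAt n j)) ⟩
    d * det (tail-minor B)         ≈⟨ *-congˡ (det-cong λ i j → minor (splitAt n i) (splitAt n j)) ⟩
    d * det (λ i j → block (scalar d) (λ _ _ → 0#) R′ S (splitAt n i) (splitAt n j))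
                                   ≈⟨ *-congˡ (det-lowerBlock d R′ S) ⟩
    d * (d ^ n * det S)            ≈⟨ *-assoc _ _ _ ⟨
    d * d ^ n * det S              ∎
    where
    R′ : Fin m → Row n
    R′ i = R i ∘ suc

    B : Matrix (suc n ℕ.+ m)
    B i j = block (scalar d) (λ _ _ → 0#) R S (splitAt (suc n) i) (splitAt (suc n) j)

    row≈0 : ∀ y → block (scalar d) (λ _ _ → 0#) R S (inj₁ zero) (map₁ suc y) ≈ 0#
    row≈0 (inj₁ _) = refl
    row≈0 (inj₂ _) = refl

    minor : ∀ x y → block (scalar d) (λ _ _ → 0#) R S (map₁ suc x) (map₁ suc y) ≈
                    block (scalar d) (λ _ _ → 0#) R′ S x y
    minor (inj₁ _) (inj₁ _) = refl
    minor (inj₁ _) (inj₂ _) = refl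
    minor (inj₂ _) (inj₁ _) = refl
    minor (inj₂ _) (inj₂ _) = refl

  det-upperBlock : ∀ {n m} d (U : Fin n → Row m) (S : Matrix m) →
                   det (λ i j → block (scalar d) U (λ _ _ → 0#) S (splitAt n i) (splitAt n j)) ≈ d ^ n * det S
  det-upperBlock {zero}      d U S = sym (*-identityˡ _)
  det-upperBlock {suc n} {m} d U S = begin
    det B                          ≈⟨ det-headColumn B (λ i → column≈0 (splitAt n i)) ⟩
    d * det (tail-minor B)         ≈⟨ *-congˡ (det-cong λ i j → minor (splitAt n i) (splitAt n j)) ⟩
    d * det (λ i j → block (scalar d) (U ∘ suc) (λ _ _ → 0#) S (splitAt n i) (splitAt n j))
                                   ≈⟨ *-congˡ (det-upperBlock d (U ∘ suc) S) ⟩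
    d * (d ^ n * det S)            ≈⟨ *-assoc _ _ _ ⟨
    d * d ^ n * det S              ∎
    where
    B : Matrix (suc n ℕ.+ m)
    B i j = block (scalar d) U (λ _ _ → 0#) S (splitAt (suc n) i) (splitAt (suc n) j)

    column≈0 : ∀ x → block (scalar d) U (λ _ _ → 0#) S (map₁ suc x) (inj₁ zero) ≈ 0#
    column≈0 (inj₁ _) = refl
    column≈0 (inj₂ _) = refl

    minor : ∀ x y → block (scalar d) U (λ _ _ → 0#) S (map₁ suc x) (map₁ suc y) ≈
                    block (scalar d) (U ∘ suc) (λ _ _ → 0#) S x y
    minor (inj₁ _) (inj₁ _) = refl
    minor (inj₁ _) (inj₂ _) = refl
    minor (inj₂ _) (inj₁ _) = refl
    minor (inj₂ _) (inj₂ _) = refl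

  -- The test `i ≟ j` in the sum type of indices does not reduce along `splitAt`, so the blocks of a
  -- diagonal matrix have to be found by induction on `n`.
  diagonal-splitAt : ∀ {n m} (d : Fin n ⊎ Fin m → Carrier) i j →
                     diagonal (d ∘ splitAt n) i j ≈
                     block (diagonal (d ∘ inj₁)) (λ _ _ → 0#) (λ _ _ → 0#) (diagonal (d ∘ inj₂))
                           (splitAt n i) (splitAt n j)
  diagonal-splitAt {zero}  d i j = refl
  diagonal-splitAt {suc n} d zero    zero    = refl
  diagonal-splitAt {suc n} d zero    (suc j) with splitAt n j
  ... | inj₁ _ = refl
  ... | inj₂ _ = refl
  diagonal-splitAt {suc n} d (suc i) zero    with splitAt n i
  ... | inj₁ _ = refl
  ... | inj₂ _ = refl
  diagonal-splitAt {suc n} d (suc i) (suc j) =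
    trans (diagonal-splitAt {n} (d ∘ map₁ suc) i j) (shift (splitAt n i) (splitAt n j))
    where
    shift : ∀ x y → block (diagonal (d ∘ inj₁ ∘ suc)) (λ _ _ → 0#) (λ _ _ → 0#) (diagonal (d ∘ inj₂)) x y ≈
                    block (diagonal (d ∘ inj₁)) (λ _ _ → 0#) (λ _ _ → 0#) (diagonal (d ∘ inj₂)) (map₁ suc x) (map₁ suc y)
    shift (inj₁ _) (inj₁ _) = refl
    shift (inj₁ _) (inj₂ _) = refl
    shift (inj₂ _) (inj₁ _) = refl
    shift (inj₂ _) (inj₂ _) = refl

  -- A border absorbs the rank one part e rᵀ of C.
  module _ {n} (C : Matrix n) (e r : Row n) (s : Carrier) where

    bordered : Matrix (suc n)
    bordered zero    zero    = s + sum λ j → r j * e j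
    bordered zero    (suc j) = - r j
    bordered (suc i) zero    = s * e i - sum λ j → (C i j - e i * r j) * e j
    bordered (suc i) (suc j) = C i j - e i * r j

    -- `bordered` is a product of three block triangular matrices with determinants `1`, `det C` and
    -- `s`. Below the corner its first column is `s e - (C - e rᵀ) e`, which vanishes in the rows
    -- where `e` behaves as an eigenvector of `C - e rᵀ` for `s`; this guides the choice of `s`.
    det-bordered : s * det C ≈ det bordered
    det-bordered = begin
      s * det C
        ≈⟨ solve 2 (λ s d → s :* d := (:1 :* :1) :* (:1 :* d) :* (s :* :1)) refl s (det C) ⟩
      1# * 1# * (1# * det C) * (s * 1#)
        ≈⟨ *-cong (*-cong (*-congˡ (det-𝟙 {n})) refl) (*-congˡ (det-𝟙 {n})) ⟨
      1# * det (𝟙 {n}) * (1# * det C) * (s * det (𝟙 {n}))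
        ≈⟨ *-cong (*-cong (det-headRow left λ _ → refl) (det-headColumn middle λ _ → refl))
                  (det-headRow right λ _ → refl) ⟨
      det left * det middle * det right     ≈⟨ *-congʳ (det-⊗ left middle) ⟨
      det (left ⊗ middle) * det right       ≈⟨ det-⊗ (left ⊗ middle) right ⟨
      det (left ⊗ middle ⊗ right)
        ≈⟨ det-cong {M = left ⊗ middle ⊗ right} {λ i j → sum λ k → product i k * right k j}
             (λ i j → sum-cong-≋ {suc n} λ k → *-congʳ {right k j} (left⊗middle i k)) ⟩
      det (λ i j → sum λ k → product i k * right k j)
        ≈⟨ det-cong product⊗right ⟩
      det bordered ∎
      where
      left middle right product : Matrix (suc n)
      left zero    zero    = 1#
      left zero    (suc j) = 0#
      left (suc i) zero    = e i
      left (suc i) (suc j) = 𝟙 i j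

      middle zero    zero    = 1#
      middle zero    (suc j) = - r j
      middle (suc i) zero    = 0#
      middle (suc i) (suc j) = C i j

      right zero    zero    = s
      right zero    (suc j) = 0#
      right (suc i) zero    = - e i
      right (suc i) (suc j) = 𝟙 i j

      product zero    zero    = 1#
      product zero    (suc j) = - r j
      product (suc i) zero    = e i
      product (suc i) (suc j) = C i j - e i * r j

      left⊗middle : (left ⊗ middle) ≋₂ product
      left⊗middle zero zero =
        trans (+-cong (*-identityˡ _) (sum-zero {n} λ _ → zeroˡ _)) (+-identityʳ _)
      left⊗middle zero (suc j) =
        trans (+-cong (*-identityˡ _) (sum-zero {n} λ _ → zeroˡ _)) (+-identityʳ _)
      left⊗middle (suc i) zero =
        trans (+-cong (*-identityʳ _) (sum-zero {n} λ _ → zeroʳ _)) (+-identityʳ _)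
      left⊗middle (suc i) (suc j) = begin
        e i * - r j + sum (λ k → 𝟙 i k * C k j)
          ≈⟨ +-congˡ (sum-diagonalˡ (λ _ → 1#) i λ k → C k j) ⟩
        e i * - r j + 1# * C i j
          ≈⟨ solve 3 (λ e r c → e :* (:- r) :+ :1 :* c := c :- e :* r) refl (e i) (r j) (C i j) ⟩
        C i j - e i * r j ∎

      sum-neg : ∀ (f g : Row n) → sum (λ k → f k * - g k) ≈ - sum (λ k → f k * g k)
      sum-neg f g = begin
        sum (λ k → f k * - g k)
          ≈⟨ sum-cong-≋ {n} (λ k → solve 2 (λ f g → f :* (:- g) := (:- :1) :* (f :* g)) refl (f k) (g k)) ⟩
        sum (λ k → - 1# * (f k * g k))
          ≈⟨ *-distribˡ-sum {n} (- 1#) (λ k → f k * g k) ⟨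
        - 1# * sum (λ k → f k * g k)
          ≈⟨ solve 1 (λ x → (:- :1) :* x := :- x) refl _ ⟩
        - sum (λ k → f k * g k) ∎

      product⊗right : (product ⊗ right) ≋₂ bordered
      product⊗right zero zero = +-cong (*-identityˡ _)
        (sum-cong-≋ {n} λ k → solve 2 (λ r e → (:- r) :* (:- e) := r :* e) refl (r k) (e k))
      product⊗right zero (suc j) = trans (+-cong (zeroʳ _) (sum-diagonalʳ (λ _ → 1#) j λ k → - r k))
        (trans (+-identityˡ _) (*-identityʳ _))
      product⊗right (suc i) zero = +-cong (*-comm _ _) (sum-neg (λ k → C i k - e i * r k) e)
      product⊗right (suc i) (suc j) =
        trans (+-cong (zeroʳ _) (sum-diagonalʳ (λ _ → 1#) j λ k → C i k - e i * r k))
              (trans (+-identityˡ _) (*-identityʳ _))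

  embed : ∀ n m → RowMap n (suc (n ℕ.+ m))
  embed n m = record
    { map    = λ x → 0# ◂ (x ++ λ _ → 0#)
    ; cong   = embed-cong
    ; linear = embed-linear
    }
    where
    embed-cong : ∀ {x y : Row n} → x ≋ y → 0# ◂ (x ++ λ _ → 0#) ≋ 0# ◂ (y ++ λ _ → 0#)
    embed-cong x≋y zero    = refl
    embed-cong x≋y (suc j) with splitAt n j
    ... | inj₁ k = x≋y k
    ... | inj₂ _ = refl

    zero-comb : ∀ a b → 0# ≈ a * 0# + b * 0#
    zero-comb a b = sym (trans (+-cong (zeroʳ a) (zeroʳ b)) (+-identityˡ 0#))

    embed-linear : ∀ a (x : Row n) b y → 0# ◂ (comb a x b y ++ λ _ → 0#) ≋
                   comb a (0# ◂ (x ++ λ _ → 0#)) b (0# ◂ (y ++ λ _ → 0#))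
    embed-linear a x b y zero    = zero-comb a b
    embed-linear a x b y (suc j) with splitAt n j
    ... | inj₁ k = refl
    ... | inj₂ _ = zero-comb a b

  det-embed : ∀ {n m} (x : Row (suc (n ℕ.+ m))) (X : Matrix n) (Z : Fin m → Row (suc (n ℕ.+ m))) →
              det (x ◂ ((RowMap.map (embed n m) ∘ X) ++ Z)) ≈
              det X * det (x ◂ ((RowMap.map (embed n m) ∘ 𝟙) ++ Z))
  det-embed {n} {m} x X Z = alternating-unique
    (alternating-map {n} (embed n m) (alternating-++ {n} Z (alternating-tail det-alternating x))) X

-- Schur complement and determinant of a join matrix.

module JoinDeterminant {c ℓ₁ ℓ₂} (K : AlgebraicallyClosedCharZeroField c ℓ₁ ℓ₂) (n m : ℕ) where

  open Determinant K
  open Block K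
  open AlgebraicallyClosedCharZeroField K using (commutativeRing)
  open CommutativeRing commutativeRing hiding (zero)
  open import Algebra.Properties.Semiring.Sum semiring
  open import Algebra.Properties.Semiring.Exp semiring using (_^_)
  open import Algebra.Properties.Ring ring using (-0#≈0#)
  open import Relation.Binary.Reasoning.Setoid setoid
  open IntegerSolver commutativeRing
  open FiniteSum +-commutativeMonoid
  open Spectra K using (Matrix; det; characteristicPolynomial)

  -- Indices in `JoinVertex` let the nine blocks be given by clauses; `⟪_⟫` returns to an ordinary
  -- square matrix for `det`.
  JoinMatrix : Set c
  JoinMatrix = JoinVertex n m → JoinVertex n m → Carrier

  ⟪_⟫ : JoinMatrix → Matrix (n ℕ.+ (n ℕ.+ m))
  ⟪ X ⟫ i j = X (joinVertex n m i) (joinVertex n m j)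

  infixl 7 _⊛_
  _⊛_ : JoinMatrix → JoinMatrix → JoinMatrix
  (X ⊛ Y) p q = sum (λ k → X p (u k) * Y (u k) q) +
    (sum (λ k → X p (u′ k) * Y (u′ k) q) + sum (λ k → X p (v k) * Y (v k) q))

  ⟪⟫-cong : ∀ {X Y : JoinMatrix} → (∀ p q → X p q ≈ Y p q) → ⟪ X ⟫ ≋₂ ⟪ Y ⟫
  ⟪⟫-cong X≈Y i j = X≈Y (joinVertex n m i) (joinVertex n m j)

  ⟪⟫-⊛ : ∀ X Y → (⟪ X ⟫ ⊗ ⟪ Y ⟫) ≋₂ ⟪ X ⊛ Y ⟫
  ⟪⟫-⊛ X Y i j = sum-joinVertex {n} {m} λ q → X (joinVertex n m i) q * Y q (joinVertex n m j)

  ⊛-congʳ : ∀ {X Y : JoinMatrix} Z → (∀ p q → X p q ≈ Y p q) → ∀ p q → (X ⊛ Z) p q ≈ (Y ⊛ Z) p q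
  ⊛-congʳ Z X≈Y p q = +-cong (sum-cong-≋ {n} λ k → *-congʳ (X≈Y p (u k)))
    (+-cong (sum-cong-≋ {n} λ k → *-congʳ (X≈Y p (u′ k))) (sum-cong-≋ {m} λ k → *-congʳ (X≈Y p (v k))))

  det-⊛ : ∀ X Y → det ⟪ X ⊛ Y ⟫ ≈ det ⟪ X ⟫ * det ⟪ Y ⟫
  det-⊛ X Y = trans (sym (det-cong (⟪⟫-⊛ X Y))) (det-⊗ ⟪ X ⟫ ⟪ Y ⟫)

  -- Elimination without division. Multiplication on the left by `upper μ N`, with `N` the negated
  -- link block, replaces the u rows by `μ` times themselves minus the link block times the u′ rows;
  -- `lower` does the same to columns from the right. Each costs a factor `μ ^ n`.
  upper lower : Carrier → Matrix n → JoinMatrix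
  upper d N (u i)  (u j)  = scalar d i j
  upper d N (u i)  (u′ j) = N i j
  upper d N (u i)  (v j)  = 0#
  upper d N (u′ i) (u j)  = 0#
  upper d N (u′ i) (u′ j) = 𝟙 i j
  upper d N (u′ i) (v j)  = 0#
  upper d N (v i)  (u j)  = 0#
  upper d N (v i)  (u′ j) = 0#
  upper d N (v i)  (v j)  = 𝟙 i j

  lower d N (u i)  (u j)  = scalar d i j
  lower d N (u i)  (u′ j) = 0#
  lower d N (u i)  (v j)  = 0#
  lower d N (u′ i) (u j)  = N i j
  lower d N (u′ i) (u′ j) = 𝟙 i j
  lower d N (u′ i) (v j)  = 0#
  lower d N (v i)  (u j)  = 0#
  lower d N (v i)  (u′ j) = 0#
  lower d N (v i)  (v j)  = 𝟙 i j

  det-upper : ∀ d N → det ⟪ upper d N ⟫ ≈ d ^ n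
  det-upper d N = begin
    det ⟪ upper d N ⟫     ≈⟨ det-cong (λ i j → entry (splitAt n i) (splitAt n j)) ⟩
    det (λ i j → block (scalar d) U (λ _ _ → 0#) 𝟙 (splitAt n i) (splitAt n j))
                          ≈⟨ det-upperBlock {n} d U 𝟙 ⟩
    d ^ n * det (𝟙 {n ℕ.+ m}) ≈⟨ *-congˡ (det-𝟙 {n ℕ.+ m}) ⟩
    d ^ n * 1#            ≈⟨ *-identityʳ _ ⟩
    d ^ n                 ∎
    where
    rest : Fin (n ℕ.+ m) → JoinVertex n m
    rest = [ u′ , v ]′ ∘ splitAt n
    U : Fin n → Row (n ℕ.+ m)
    U i = [ N i , (λ _ → 0#) ]′ ∘ splitAt n

    entry : ∀ x y → upper d N ([ u , rest ]′ x) ([ u , rest ]′ y) ≈ block (scalar d) U (λ _ _ → 0#) 𝟙 x y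
    entry (inj₁ i) (inj₁ j) = refl
    entry (inj₁ i) (inj₂ j) with splitAt n j
    ... | inj₁ _ = refl
    ... | inj₂ _ = refl
    entry (inj₂ i) (inj₁ j) with splitAt n i
    ... | inj₁ _ = refl
    ... | inj₂ _ = refl
    entry (inj₂ i) (inj₂ j) = trans (corner (splitAt n i) (splitAt n j)) (sym (diagonal-splitAt {n} (λ _ → 1#) i j))
      where
      corner : ∀ x y → upper d N ([ u′ , v ]′ x) ([ u′ , v ]′ y) ≈ block 𝟙 (λ _ _ → 0#) (λ _ _ → 0#) 𝟙 x y
      corner (inj₁ _) (inj₁ _) = refl
      corner (inj₁ _) (inj₂ _) = refl
      corner (inj₂ _) (inj₁ _) = refl
      corner (inj₂ _) (inj₂ _) = refl

  det-lower : ∀ d N → det ⟪ lower d N ⟫ ≈ d ^ n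
  det-lower d N = begin
    det ⟪ lower d N ⟫     ≈⟨ det-cong (λ i j → entry (splitAt n i) (splitAt n j)) ⟩
    det (λ i j → block (scalar d) (λ _ _ → 0#) R 𝟙 (splitAt n i) (splitAt n j))
                          ≈⟨ det-lowerBlock {n} d R 𝟙 ⟩
    d ^ n * det (𝟙 {n ℕ.+ m}) ≈⟨ *-congˡ (det-𝟙 {n ℕ.+ m}) ⟩
    d ^ n * 1#            ≈⟨ *-identityʳ _ ⟩
    d ^ n                 ∎
    where
    rest : Fin (n ℕ.+ m) → JoinVertex n m
    rest = [ u′ , v ]′ ∘ splitAt n
    R : Fin (n ℕ.+ m) → Row n
    R i = [ N , (λ _ _ → 0#) ]′ (splitAt n i)

    entry : ∀ x y → lower d N ([ u , rest ]′ x) ([ u , rest ]′ y) ≈ block (scalar d) (λ _ _ → 0#) R 𝟙 x y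
    entry (inj₁ i) (inj₁ j) = refl
    entry (inj₁ i) (inj₂ j) with splitAt n j
    ... | inj₁ _ = refl
    ... | inj₂ _ = refl
    entry (inj₂ i) (inj₁ j) with splitAt n i
    ... | inj₁ _ = refl
    ... | inj₂ _ = refl
    entry (inj₂ i) (inj₂ j) = trans (corner (splitAt n i) (splitAt n j)) (sym (diagonal-splitAt {n} (λ _ → 1#) i j))
      where
      corner : ∀ x y → lower d N ([ u′ , v ]′ x) ([ u′ , v ]′ y) ≈ block 𝟙 (λ _ _ → 0#) (λ _ _ → 0#) 𝟙 x y
      corner (inj₁ _) (inj₁ _) = refl
      corner (inj₁ _) (inj₂ _) = refl
      corner (inj₂ _) (inj₁ _) = refl
      corner (inj₂ _) (inj₂ _) = refl

  sum-0* : ∀ {k} (f : Row k) → sum (λ i → 0# * f i) ≈ 0#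
  sum-0* {k} f = sum-zero {k} λ i → zeroˡ (f i)

  sum-*0 : ∀ {k} (f : Row k) → sum (λ i → f i * 0#) ≈ 0#
  sum-*0 {k} f = sum-zero {k} λ i → zeroʳ (f i)

  sum-𝟙ˡ : ∀ {k} i (f : Row k) → sum (λ l → 𝟙 i l * f l) ≈ f i
  sum-𝟙ˡ i f = trans (sum-diagonalˡ (λ _ → 1#) i f) (*-identityˡ _)

  sum-𝟙ʳ : ∀ {k} i (f : Row k) → sum (λ l → f l * 𝟙 l i) ≈ f i
  sum-𝟙ʳ i f = trans (sum-diagonalʳ (λ _ → 1#) i f) (*-identityʳ _)

  a+[0+0] : ∀ {a b c d} → a ≈ d → b ≈ 0# → c ≈ 0# → a + (b + c) ≈ d
  a+[0+0] a≈d b≈0 c≈0 = trans (+-cong a≈d (trans (+-cong b≈0 c≈0) (+-identityˡ _))) (+-identityʳ _)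

  0+[a+0] : ∀ {a b c d} → a ≈ 0# → b ≈ d → c ≈ 0# → a + (b + c) ≈ d
  0+[a+0] a≈0 b≈d c≈0 = trans (+-cong a≈0 (trans (+-cong b≈d c≈0) (+-identityʳ _))) (+-identityˡ _)

  0+[0+a] : ∀ {a b c d} → a ≈ 0# → b ≈ 0# → c ≈ d → a + (b + c) ≈ d
  0+[0+a] a≈0 b≈0 c≈d = trans (+-cong a≈0 (trans (+-cong b≈0 c≈d) (+-identityˡ _))) (+-identityˡ _)

  -- The two constant blocks have separate parameters because elimination produces `μ * ε` in one
  -- and `ε * μ` in the other, which agree only up to `≈`.
  joinMatrix : (S W : Matrix n) (μ ε ε′ : Carrier) (T : Matrix m) → JoinMatrix
  joinMatrix S W μ ε ε′ T (u i)  (u j)  = S i j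
  joinMatrix S W μ ε ε′ T (u i)  (u′ j) = W i j
  joinMatrix S W μ ε ε′ T (u i)  (v j)  = ε
  joinMatrix S W μ ε ε′ T (u′ i) (u j)  = W i j
  joinMatrix S W μ ε ε′ T (u′ i) (u′ j) = scalar μ i j
  joinMatrix S W μ ε ε′ T (u′ i) (v j)  = 0#
  joinMatrix S W μ ε ε′ T (v i)  (u j)  = ε′
  joinMatrix S W μ ε ε′ T (v i)  (u′ j) = 0#
  joinMatrix S W μ ε ε′ T (v i)  (v j)  = T i j

  module _ (S W : Matrix n) (μ ε : Carrier) (T : Matrix m) where

    private
      -W : Matrix n
      -W i j = - W i j

      M : JoinMatrix
      M = joinMatrix S W μ ε ε T

      half : JoinMatrix
      half (u i)  (u j)  = μ * S i j + sum λ k → -W i k * W k j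
      half (u i)  (u′ j) = 0#
      half (u i)  (v j)  = μ * ε
      half (u′ i) (u j)  = W i j
      half (u′ i) (u′ j) = scalar μ i j
      half (u′ i) (v j)  = 0#
      half (v i)  (u j)  = ε
      half (v i)  (u′ j) = 0#
      half (v i)  (v j)  = T i j

      half-correct : ∀ p q → (upper μ -W ⊛ M) p q ≈ half p q
      half-correct (u i) (u j) = +-cong (sum-diagonalˡ (λ _ → μ) i λ k → S k j)
        (trans (+-congˡ (sum-0* {m} λ _ → ε)) (+-identityʳ _))
      half-correct (u i) (u′ j) = begin
        _ ≈⟨ +-cong (sum-diagonalˡ (λ _ → μ) i λ k → W k j)
               (trans (+-cong (sum-diagonalʳ (λ _ → μ) j (-W i)) (sum-0* {m} λ _ → 0#)) (+-identityʳ _)) ⟩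
        μ * W i j + - W i j * μ  ≈⟨ +-congˡ (solve 2 (λ w μ → (:- w) :* μ := :- (μ :* w)) refl _ _) ⟩
        μ * W i j - μ * W i j    ≈⟨ -‿inverseʳ _ ⟩
        0#                       ∎
      half-correct (u i) (v j) =
        a+[0+0] (sum-diagonalˡ (λ _ → μ) i λ k → ε) (sum-*0 {n} (-W i)) (sum-0* {m} λ k → T k j)
      half-correct (u′ i) (u j) =
        0+[a+0] (sum-0* {n} λ k → S k j) (sum-𝟙ˡ i λ k → W k j) (sum-0* {m} λ _ → ε)
      half-correct (u′ i) (u′ j) =
        0+[a+0] (sum-0* {n} λ k → W k j) (sum-𝟙ˡ i λ k → scalar μ k j) (sum-0* {m} λ _ → 0#)
      half-correct (u′ i) (v j) =
        0+[a+0] (sum-0* {n} λ k → ε) (sum-𝟙ˡ i λ k → 0#) (sum-0* {m} λ k → T k j)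
      half-correct (v i) (u j) =
        0+[0+a] (sum-0* {n} λ k → S k j) (sum-0* {n} λ k → W k j) (sum-𝟙ˡ i λ _ → ε)
      half-correct (v i) (u′ j) =
        0+[0+a] (sum-0* {n} λ k → W k j) (sum-0* {n} λ k → scalar μ k j) (sum-𝟙ˡ i λ _ → 0#)
      half-correct (v i) (v j) =
        0+[0+a] (sum-0* {n} λ k → ε) (sum-0* {n} λ k → 0#) (sum-𝟙ˡ i λ k → T k j)

    -- The product of upper μ (-W), the join matrix and lower μ (-W).
    decoupled : JoinMatrix
    decoupled = joinMatrix (λ i j → (μ * S i j + sum λ k → - W i k * W k j) * μ) (λ _ _ → 0#) μ (μ * ε) (ε * μ) T

    private
      half-u′ : ∀ p j → (half ⊛ lower μ -W) p (u′ j) ≈ half p (u′ j)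
      half-u′ p j = 0+[a+0] (sum-*0 {n} λ k → half p (u k)) (sum-𝟙ʳ j λ k → half p (u′ k)) (sum-*0 {m} λ k → half p (v k))

      half-v : ∀ p j → (half ⊛ lower μ -W) p (v j) ≈ half p (v j)
      half-v p j = 0+[0+a] (sum-*0 {n} λ k → half p (u k)) (sum-*0 {n} λ k → half p (u′ k)) (sum-𝟙ʳ j λ k → half p (v k))

      decoupled-correct : ∀ p q → (half ⊛ lower μ -W) p q ≈ decoupled p q
      decoupled-correct (u i) (u j) = a+[0+0] (sum-diagonalʳ (λ _ → μ) j λ k → half (u i) (u k))
        (sum-0* {n} λ k → -W k j) (sum-*0 {m} λ _ → μ * ε)
      decoupled-correct (u′ i) (u j) = begin
        _ ≈⟨ +-cong (sum-diagonalʳ (λ _ → μ) j (W i))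
               (trans (+-cong (sum-diagonalˡ (λ _ → μ) i λ k → -W k j) (sum-0* {m} λ _ → 0#)) (+-identityʳ _)) ⟩
        W i j * μ + μ * - W i j  ≈⟨ +-congˡ (solve 2 (λ w μ → μ :* (:- w) := :- (w :* μ)) refl _ _) ⟩
        W i j * μ - W i j * μ    ≈⟨ -‿inverseʳ _ ⟩
        0#                       ∎
      decoupled-correct (v i) (u j) = a+[0+0] (sum-diagonalʳ (λ _ → μ) j λ _ → ε)
        (sum-0* {n} λ k → -W k j) (sum-*0 {m} (T i))
      decoupled-correct (u i)  (u′ j) = half-u′ (u i) j
      decoupled-correct (u′ i) (u′ j) = half-u′ (u′ i) j
      decoupled-correct (v i)  (u′ j) = half-u′ (v i) j
      decoupled-correct (u i)  (v j)  = half-v (u i) j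
      decoupled-correct (u′ i) (v j)  = half-v (u′ i) j
      decoupled-correct (v i)  (v j)  = half-v (v i) j

    det-decoupled : det ⟪ decoupled ⟫ ≈ μ ^ n * det ⟪ joinMatrix S W μ ε ε T ⟫ * μ ^ n
    det-decoupled = begin
      det ⟪ decoupled ⟫
        ≈⟨ det-cong (⟪⟫-cong λ p q → trans (⊛-congʳ (lower μ -W) half-correct p q) (decoupled-correct p q)) ⟨
      det ⟪ upper μ -W ⊛ M ⊛ lower μ -W ⟫
        ≈⟨ det-⊛ (upper μ -W ⊛ M) (lower μ -W) ⟩
      det ⟪ upper μ -W ⊛ M ⟫ * det ⟪ lower μ -W ⟫
        ≈⟨ *-cong (trans (det-⊛ (upper μ -W) M) (*-congʳ (det-upper μ -W))) (det-lower μ -W) ⟩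
      μ ^ n * det ⟪ M ⟫ * μ ^ n ∎

  module _ (s g μ κ κ′ : Carrier) (T : Matrix m) where

    private
      -- `e rᵀ` is the part of the u rows that has constant blocks: `g` times all ones towards u and
      -- `κ` times all ones towards v. Without it the u rows are those of `X` padded with zeros.
      e r : JoinVertex n m → Carrier
      e (u _)  = 1#
      e (u′ _) = 0#
      e (v _)  = 0#

      r (u _)  = g
      r (u′ _) = 0#
      r (v _)  = κ

      top : Row (suc (n ℕ.+ (n ℕ.+ m)))
      top zero    = s + sum λ j → r (joinVertex n m j) * e (joinVertex n m j)
      top (suc j) = - r (joinVertex n m j)

      bottom : Fin n ⊎ Fin m → Row (suc (n ℕ.+ (n ℕ.+ m)))
      bottom (inj₁ i) zero    = 0#
      bottom (inj₂ i) zero    = - sum {n} λ _ → κ′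
      bottom (inj₁ i) (suc j) = joinMatrix (λ _ _ → 0#) (λ _ _ → 0#) μ κ κ′ T (u′ i) (joinVertex n m j)
      bottom (inj₂ i) (suc j) = joinMatrix (λ _ _ → 0#) (λ _ _ → 0#) μ κ κ′ T (v i) (joinVertex n m j)

    -- Built from `s`, `g`, `μ`, `κ`, `κ′` and `T` alone, hence the same for two joins that differ
    -- only in `S` and `X`.
    joinCofactor : Carrier
    joinCofactor = det (top ◂ ((RowMap.map (embed n (n ℕ.+ m)) ∘ 𝟙) ++ (bottom ∘ splitAt n)))

    module _ (S X : Matrix n) (S≈X+g : ∀ i j → S i j ≈ X i j + g) (rowSum : ∀ i → sum (X i) ≈ s) where

      private
        C : JoinMatrix
        C = joinMatrix S (λ _ _ → 0#) μ κ κ′ T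

        expected : Fin n ⊎ Fin (n ℕ.+ m) → Row (suc (n ℕ.+ (n ℕ.+ m)))
        expected = [ RowMap.map (embed n (n ℕ.+ m)) ∘ X , bottom ∘ splitAt n ]′

        rest : Fin n ⊎ Fin m → JoinVertex n m
        rest = [ u′ , v ]′

        vertex : Fin n ⊎ Fin (n ℕ.+ m) → JoinVertex n m
        vertex = [ u , rest ∘ splitAt n ]′

        cleared : ∀ p → sum (λ j → (C p (joinVertex n m j) - e p * r (joinVertex n m j)) * e (joinVertex n m j)) ≈
                        sum (λ k → C p (u k) - e p * g)
        cleared p = trans (sum-joinVertex {n} {m} λ q → (C p q - e p * r q) * e q)
          (a+[0+0] (sum-cong-≋ {n} λ k → *-identityʳ (C p (u k) - e p * g))
                   (sum-*0 {n} λ k → C p (u′ k) - e p * 0#) (sum-*0 {m} λ k → C p (v k) - e p * κ))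

        a-0b≈a : ∀ a b → a - 0# * b ≈ a
        a-0b≈a a b = trans (+-congˡ (trans (-‿cong (zeroˡ b)) -0#≈0#)) (+-identityʳ a)

        firstColumn′ : ∀ x → s * e (rest x) - sum (λ k → C (rest x) (u k) - e (rest x) * g) ≈ bottom x zero
        firstColumn′ (inj₁ i) = trans (+-cong (zeroʳ s) (trans (-‿cong (sum-zero {n} λ k → a-0b≈a 0# g)) -0#≈0#))
                                      (+-identityˡ 0#)
        firstColumn′ (inj₂ i) = trans (+-cong (zeroʳ s) (-‿cong (sum-cong-≋ {n} λ k → a-0b≈a κ′ g))) (+-identityˡ _)

        firstColumn : ∀ x → s * e (vertex x) - sum (λ k → C (vertex x) (u k) - e (vertex x) * g) ≈ expected x zero
        firstColumn (inj₁ i) = begin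
          s * 1# - sum (λ k → S i k - 1# * g)
            ≈⟨ +-cong (*-identityʳ s) (-‿cong (trans (sum-cong-≋ {n} λ k → S-g i k) (rowSum i))) ⟩
          s - s
            ≈⟨ -‿inverseʳ s ⟩
          0# ∎
          where
          S-g : ∀ i k → S i k - 1# * g ≈ X i k
          S-g i k = trans (+-congʳ (S≈X+g i k)) (solve 2 (λ x g → (x :+ g) :- (:1 :* g) := x) refl (X i k) g)
        firstColumn (inj₂ k) = firstColumn′ (splitAt n k)

        a-1a≈0 : ∀ a → a - 1# * a ≈ 0#
        a-1a≈0 a = trans (+-congˡ (-‿cong (*-identityˡ a))) (-‿inverseʳ a)

        entries′ : ∀ x q → C (rest x) q - e (rest x) * r q ≈
                           joinMatrix (λ _ _ → 0#) (λ _ _ → 0#) μ κ κ′ T (rest x) q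
        entries′ (inj₁ i) (u j)  = a-0b≈a _ _
        entries′ (inj₁ i) (u′ j) = a-0b≈a _ _
        entries′ (inj₁ i) (v j)  = a-0b≈a _ _
        entries′ (inj₂ i) (u j)  = a-0b≈a _ _
        entries′ (inj₂ i) (u′ j) = a-0b≈a _ _
        entries′ (inj₂ i) (v j)  = a-0b≈a _ _

        bottom-suc : ∀ x j → joinMatrix (λ _ _ → 0#) (λ _ _ → 0#) μ κ κ′ T (rest x) (joinVertex n m j) ≈ bottom x (suc j)
        bottom-suc (inj₁ i) j = refl
        bottom-suc (inj₂ i) j = refl

        entries : ∀ x j → C (vertex x) (joinVertex n m j) - e (vertex x) * r (joinVertex n m j) ≈ expected x (suc j)
        entries (inj₁ i) j with splitAt n j
        ... | inj₁ k = trans (+-congʳ (S≈X+g i k)) (solve 2 (λ x g → (x :+ g) :- (:1 :* g) := x) refl (X i k) g)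
        ... | inj₂ k with splitAt n k
        ...   | inj₁ l = a-1a≈0 0#
        ...   | inj₂ l = a-1a≈0 κ
        entries (inj₂ k) j = trans (entries′ (splitAt n k) (joinVertex n m j)) (bottom-suc (splitAt n k) j)

        rows : bordered ⟪ C ⟫ (e ∘ joinVertex n m) (r ∘ joinVertex n m) s ≋₂
               top ◂ ((RowMap.map (embed n (n ℕ.+ m)) ∘ X) ++ (bottom ∘ splitAt n))
        rows zero    zero    = refl
        rows zero    (suc j) = refl
        rows (suc i) zero    = trans (+-congˡ (-‿cong (cleared (joinVertex n m i)))) (firstColumn (splitAt n i))
        rows (suc i) (suc j) = entries (splitAt n i) j

      -- The all-ones vector is an eigenvector of `X` for `s`, so the border's first column vanishes
      -- on the u rows. These become padded rows of `X`, and `det-embed` extracts `det X`.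
      det-rankOne : s * det ⟪ joinMatrix S (λ _ _ → 0#) μ κ κ′ T ⟫ ≈ det X * joinCofactor
      det-rankOne = begin
        s * det ⟪ C ⟫
          ≈⟨ det-bordered ⟪ C ⟫ (e ∘ joinVertex n m) (r ∘ joinVertex n m) s ⟩
        det (bordered ⟪ C ⟫ (e ∘ joinVertex n m) (r ∘ joinVertex n m) s)
          ≈⟨ det-cong rows ⟩
        det (top ◂ ((RowMap.map (embed n (n ℕ.+ m)) ∘ X) ++ (bottom ∘ splitAt n)))
          ≈⟨ det-embed {n} top X (bottom ∘ splitAt n) ⟩
        det X * joinCofactor ∎

  -- Up to a multiple of J, the Schur complement of the u′ block is a quadratic
  -- in A; y and z are its roots.
  module _ (A W : Matrix n) (ρ β γ c : Carrier) (A-rowSum : ∀ i → sum (A i) ≈ ρ)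
           (W² : ∀ i j → (W ⊗ W) i j ≈ (A ⊗ A) i j + β * A i j + γ * 𝟙 i j + c) where

    private
      shifted : Carrier → Matrix n
      shifted y i j = scalar y i j - A i j

      scalar-rowSum : ∀ y (i : Fin n) → sum (scalar y i) ≈ y
      scalar-rowSum y i = trans (sum-cong-≋ {n} λ k → sym (*-identityʳ _))
        (trans (sum-diagonalˡ (λ _ → y) i λ _ → 1#) (*-identityʳ y))

      sum-neg : ∀ (f : Row n) → sum (λ k → - f k) ≈ - sum f
      sum-neg f = begin
        sum (λ k → - f k)       ≈⟨ sum-cong-≋ {n} (λ k → solve 1 (λ x → :- x := (:- :1) :* x) refl (f k)) ⟩
        sum (λ k → - 1# * f k)  ≈⟨ *-distribˡ-sum {n} (- 1#) f ⟨
        - 1# * sum f            ≈⟨ solve 1 (λ x → (:- :1) :* x := :- x) refl _ ⟩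
        - sum f                 ∎

      shifted-rowSum : ∀ y i → sum (shifted y i) ≈ y - ρ
      shifted-rowSum y i = trans (∑-distrib-+ (scalar y i) λ k → - A i k)
        (+-cong (scalar-rowSum y i) (trans (sum-neg (A i)) (-‿cong (A-rowSum i))))

      ⊗-rowSum : ∀ (M N : Matrix n) {a b} → (∀ i → sum (M i) ≈ a) → (∀ i → sum (N i) ≈ b) →
                 ∀ i → sum ((M ⊗ N) i) ≈ a * b
      ⊗-rowSum M N {a} {b} M-rowSum N-rowSum i = begin
        sum (λ j → sum λ k → M i k * N k j)
          ≈⟨ ∑-comm (λ j k → M i k * N k j) ⟩
        sum (λ k → sum λ j → M i k * N k j)
          ≈⟨ sum-cong-≋ {n} (λ k → trans (sym (*-distribˡ-sum {n} (M i k) (N k))) (*-congˡ (N-rowSum k))) ⟩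
        sum (λ k → M i k * b)
          ≈⟨ *-distribʳ-sum {n} b (M i) ⟨
        sum (M i) * b
          ≈⟨ *-congʳ (M-rowSum i) ⟩
        a * b ∎

      scalar-𝟙 : ∀ y (i j : Fin n) → scalar y i j ≈ y * 𝟙 i j
      scalar-𝟙 y i j = trans (sym (sum-𝟙ʳ j (scalar y i))) (sum-diagonalˡ (λ _ → y) i λ k → 𝟙 k j)

      shifted-⊗ : ∀ y z i j → (shifted y ⊗ shifted z) i j ≈ (A ⊗ A) i j - (y + z) * A i j + y * z * 𝟙 i j
      shifted-⊗ y z i j = begin
        sum (λ k → shifted y i k * shifted z k j)
          ≈⟨ sum-cong-≋ {n} (λ k → solve 4 (λ p q a b → (p :- a) :* (q :- b) := (p :* (q :- b) :+ a :* b) :+ (:- a) :* q)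
               refl (scalar y i k) (scalar z k j) (A i k) (A k j)) ⟩
        sum (λ k → (scalar y i k * shifted z k j + A i k * A k j) + - A i k * scalar z k j)
          ≈⟨ trans (∑-distrib-+ (λ k → scalar y i k * shifted z k j + A i k * A k j) (λ k → - A i k * scalar z k j))
               (+-congʳ (∑-distrib-+ (λ k → scalar y i k * shifted z k j) (λ k → A i k * A k j))) ⟩
        (sum (λ k → scalar y i k * shifted z k j) + (A ⊗ A) i j) + sum (λ k → - A i k * scalar z k j)
          ≈⟨ +-cong (+-congʳ (sum-diagonalˡ (λ _ → y) i λ k → shifted z k j)) (sum-diagonalʳ (λ _ → z) j λ k → - A i k) ⟩
        (y * (scalar z i j - A i j) + (A ⊗ A) i j) + - A i j * z
          ≈⟨ +-congʳ (+-congʳ (*-congˡ (+-congʳ (scalar-𝟙 z i j)))) ⟩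
        (y * (z * 𝟙 i j - A i j) + (A ⊗ A) i j) + - A i j * z
          ≈⟨ solve 5 (λ y z δ a b → (y :* (z :* δ :- a) :+ b) :+ (:- a) :* z := b :- (y :+ z) :* a :+ y :* z :* δ)
               refl y z (𝟙 i j) (A i j) ((A ⊗ A) i j) ⟩
        (A ⊗ A) i j - (y + z) * A i j + y * z * 𝟙 i j ∎

    -- With `S = σ I + ε A` and link block `ε W`, elimination leaves `μ (μ S - ε² W²)` in the u
    -- block. As `ε² = 1`, this is `- μ (A² - (μ ε - β) A + (γ - μ σ) I) - μ c
    -- J`, and the conditions on `y + z` and `y * z` turn it into `- μ (y I - A) (z I - A) - μ c J`.
    det-joinMatrix : ∀ (σ μ ε y z : Carrier) (T : Matrix m) → ε * ε ≈ 1# →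
      y + z ≈ μ * ε - β → y * z ≈ γ - μ * σ →
      - μ * (y - ρ) * (z - ρ) *
        (μ ^ n * det ⟪ joinMatrix (λ i j → scalar σ i j + ε * A i j) (λ i j → ε * W i j) μ ε ε T ⟫ * μ ^ n) ≈
      det {n} (scalar (- μ)) * characteristicPolynomial A y * characteristicPolynomial A z *
        joinCofactor (- μ * (y - ρ) * (z - ρ)) (- (μ * c)) μ (μ * ε) (ε * μ) T
    det-joinMatrix σ μ ε y z T ε²≈1 y+z yz = begin
      s * (μ ^ n * det ⟪ joinMatrix S εW μ ε ε T ⟫ * μ ^ n)
        ≈⟨ *-congˡ (det-decoupled S εW μ ε T) ⟨
      s * det ⟪ decoupled S εW μ ε T ⟫
        ≈⟨ det-rankOne s (- (μ * c)) μ (μ * ε) (ε * μ) T _ X S≈X+g X-rowSum ⟩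
      det X * joinCofactor s (- (μ * c)) μ (μ * ε) (ε * μ) T
        ≈⟨ *-congʳ (trans (det-⊗ (scalar (- μ) ⊗ shifted y) (shifted z)) (*-congʳ (det-⊗ (scalar (- μ)) (shifted y)))) ⟩
      det {n} (scalar (- μ)) * det (shifted y) * det (shifted z) * joinCofactor s (- (μ * c)) μ (μ * ε) (ε * μ) T ∎
      where
      s : Carrier
      -- The row sum of `X`, multiplied together from the row sums of its three factors.
      s = - μ * (y - ρ) * (z - ρ)

      S εW X : Matrix n
      S i j = scalar σ i j + ε * A i j
      εW i j = ε * W i j
      X = scalar (- μ) ⊗ shifted y ⊗ shifted z

      X-rowSum : ∀ i → sum (X i) ≈ s
      X-rowSum = ⊗-rowSum (scalar (- μ) ⊗ shifted y) (shifted z)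
        (⊗-rowSum (scalar (- μ)) (shifted y) (scalar-rowSum (- μ)) (shifted-rowSum y)) (shifted-rowSum z)

      X-entry : ∀ i j → X i j ≈ - μ * ((A ⊗ A) i j - (y + z) * A i j + y * z * 𝟙 i j)
      X-entry i j = begin
        sum (λ k → sum (λ l → scalar (- μ) i l * shifted y l k) * shifted z k j)
          ≈⟨ sum-cong-≋ {n} (λ k → trans (*-congʳ (sum-diagonalˡ (λ _ → - μ) i λ l → shifted y l k)) (*-assoc _ _ _)) ⟩
        sum (λ k → - μ * (shifted y i k * shifted z k j))
          ≈⟨ *-distribˡ-sum {n} (- μ) (λ k → shifted y i k * shifted z k j) ⟨
        - μ * (shifted y ⊗ shifted z) i j
          ≈⟨ *-congˡ (shifted-⊗ y z i j) ⟩
        - μ * ((A ⊗ A) i j - (y + z) * A i j + y * z * 𝟙 i j) ∎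

      εW² : ∀ i j → sum (λ k → - εW i k * εW k j) ≈ - ((A ⊗ A) i j + β * A i j + γ * 𝟙 i j + c)
      εW² i j = begin
        sum (λ k → - (ε * W i k) * (ε * W k j))
          ≈⟨ sum-cong-≋ {n} (λ k → solve 3 (λ ε a b → (:- (ε :* a)) :* (ε :* b) := (:- (ε :* ε)) :* (a :* b))
               refl ε (W i k) (W k j)) ⟩
        sum (λ k → - (ε * ε) * (W i k * W k j))
          ≈⟨ *-distribˡ-sum {n} (- (ε * ε)) (λ k → W i k * W k j) ⟨
        - (ε * ε) * (W ⊗ W) i j
          ≈⟨ *-cong (-‿cong ε²≈1) (W² i j) ⟩
        - 1# * ((A ⊗ A) i j + β * A i j + γ * 𝟙 i j + c)
          ≈⟨ solve 1 (λ x → (:- :1) :* x := :- x) refl _ ⟩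
        - ((A ⊗ A) i j + β * A i j + γ * 𝟙 i j + c) ∎

      S≈X+g : ∀ i j → (μ * S i j + sum λ k → - εW i k * εW k j) * μ ≈ X i j + - (μ * c)
      S≈X+g i j = begin
        (μ * (scalar σ i j + ε * A i j) + sum λ k → - εW i k * εW k j) * μ
          ≈⟨ *-congʳ (+-cong (*-congˡ (+-congʳ (scalar-𝟙 σ i j))) (εW² i j)) ⟩
        (μ * (σ * 𝟙 i j + ε * A i j) + - ((A ⊗ A) i j + β * A i j + γ * 𝟙 i j + c)) * μ
          ≈⟨ solve 9 (λ μ σ δ ε a b β γ c →
               (μ :* (σ :* δ :+ ε :* a) :+ :- (b :+ β :* a :+ γ :* δ :+ c)) :* μ :=
               (:- μ) :* (b :- (μ :* ε :- β) :* a :+ (γ :- μ :* σ) :* δ) :+ :- (μ :* c))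
               refl μ σ (𝟙 i j) ε (A i j) ((A ⊗ A) i j) β γ c ⟩
        - μ * ((A ⊗ A) i j - (μ * ε - β) * A i j + (γ - μ * σ) * 𝟙 i j) - μ * c
          ≈⟨ +-congʳ (*-congˡ (+-cong (+-congˡ (-‿cong (*-congʳ y+z))) (*-congʳ yz))) ⟨
        - μ * ((A ⊗ A) i j - (y + z) * A i j + y * z * 𝟙 i j) - μ * c
          ≈⟨ +-congʳ (X-entry i j) ⟨
        X i j - μ * c ∎

-- Polynomial functions in Horner form: splitting and cancellation.

module PolynomialFunction {c ℓ₁ ℓ₂} (K : AlgebraicallyClosedCharZeroField c ℓ₁ ℓ₂) where

  open Block K using (scalar)
  open AlgebraicallyClosedCharZeroField K
    using (commutativeRing; characteristicZero; root; #⇒invertible; _·_)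
  open CommutativeRing commutativeRing hiding (zero)
  open import Algebra.Properties.Semiring.Sum semiring
  open import Algebra.Properties.Semiring.Exp semiring using (_^_)
  open import Algebra.Properties.Ring ring using (-0#≈0#)
  open import Relation.Binary.Reasoning.Setoid setoid
  open IntegerSolver commutativeRing
  open Spectra K using (Matrix; det; characteristicPolynomial)

  -- A polynomial is a function with a Horner decomposition, in keeping with spectra that compare
  -- characteristic polynomials pointwise. Only an upper bound is recorded, so no leading
  -- coefficient has to be tested for zero.
  Degree< : ℕ → (Carrier → Carrier) → Set (c ⊔ ℓ₁)
  Degree< zero    f = Lift c (∀ x → f x ≈ 0#)
  Degree< (suc d) f = ∃ λ a → ∃ λ g → Degree< d g × ∀ x → f x ≈ a + x * g x

  Monic : ℕ → (Carrier → Carrier) → Set (c ⊔ ℓ₁)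
  Monic zero    f = Lift c (∀ x → f x ≈ 1#)
  Monic (suc d) f = ∃ λ a → ∃ λ g → Monic d g × ∀ x → f x ≈ a + x * g x

  degree-resp : ∀ {d f g} → (∀ x → g x ≈ f x) → Degree< d f → Degree< d g
  degree-resp {zero}  g≈f (lift f≈0)        = lift λ x → trans (g≈f x) (f≈0 x)
  degree-resp {suc d} g≈f (a , h , hd , f≈) = a , h , hd , λ x → trans (g≈f x) (f≈ x)

  monic-resp : ∀ {d f g} → (∀ x → g x ≈ f x) → Monic d f → Monic d g
  monic-resp {zero}  g≈f (lift f≈1)        = lift λ x → trans (g≈f x) (f≈1 x)
  monic-resp {suc d} g≈f (a , h , hd , f≈) = a , h , hd , λ x → trans (g≈f x) (f≈ x)

  degree-congruent : ∀ {d f} → Degree< d f → ∀ {x y} → x ≈ y → f x ≈ f y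
  degree-congruent {zero}  (lift f≈0)        x≈y = trans (f≈0 _) (sym (f≈0 _))
  degree-congruent {suc d} (a , h , hd , f≈) x≈y =
    trans (f≈ _) (trans (+-congˡ (*-cong x≈y (degree-congruent {d} hd x≈y))) (sym (f≈ _)))

  degree-zero : ∀ d → Degree< d λ _ → 0#
  degree-zero zero    = lift λ _ → refl
  degree-zero (suc d) = 0# , _ , degree-zero d , λ x → sym (trans (+-identityˡ _) (zeroʳ x))

  degree-const : ∀ {d} a → Degree< (suc d) λ _ → a
  degree-const {d} a = a , _ , degree-zero d , λ x → sym (trans (+-congˡ (zeroʳ x)) (+-identityʳ a))

  degree-id : Degree< 2 λ x → x
  degree-id = 0# , _ , degree-const 1# , λ x → sym (trans (+-identityˡ _) (*-identityʳ x))

  degree-+ : ∀ {d f g} → Degree< d f → Degree< d g → Degree< d λ x → f x + g x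
  degree-+ {zero}  (lift f≈0) (lift g≈0) = lift λ x → trans (+-cong (f≈0 x) (g≈0 x)) (+-identityˡ 0#)
  degree-+ {suc d} (a , f′ , f′d , f≈) (b , g′ , g′d , g≈) =
    a + b , _ , degree-+ {d} f′d g′d , λ x → trans (+-cong (f≈ x) (g≈ x))
      (solve 5 (λ a b x f g → (a :+ x :* f) :+ (b :+ x :* g) := (a :+ b) :+ x :* (f :+ g))
         refl a b x (f′ x) (g′ x))

  degree-* : ∀ {d f} b → Degree< d f → Degree< d λ x → b * f x
  degree-* {zero}  b (lift f≈0) = lift λ x → trans (*-congˡ (f≈0 x)) (zeroʳ b)
  degree-* {suc d} b (a , f′ , f′d , f≈) =
    b * a , _ , degree-* {d} b f′d , λ x → trans (*-congˡ (f≈ x))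
      (solve 4 (λ a b x f → b :* (a :+ x :* f) := b :* a :+ x :* (b :* f)) refl a b x (f′ x))

  degree-sum : ∀ {d n} {f : Fin n → Carrier → Carrier} → (∀ k → Degree< d (f k)) →
               Degree< d λ x → sum λ k → f k x
  degree-sum {d} {zero}  fd = degree-zero d
  degree-sum {d} {suc n} fd = degree-+ {d} (fd zero) (degree-sum {d} {n} (λ k → fd (suc k)))

  degree-suc : ∀ {d f} → Degree< d f → Degree< (suc d) f
  degree-suc {zero}  (lift f≈0)          = degree-resp {1} f≈0 (degree-zero 1)
  degree-suc {suc d} (a , f′ , f′d , f≈) = a , f′ , degree-suc {d} f′d , f≈

  -- Products with one linear factor are enough: a Laplace expansion multiplies a minor by a single
  -- entry, and a monic polynomial is cancelled root by root.
  degree-linear* : ∀ {d l f} → Degree< 2 l → Degree< d f → Degree< (suc d) λ x → l x * f x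
  degree-linear* {d} {l} {f} (a , l′ , (b , l″ , lift l″≈0 , l′≈) , l≈) fd =
    degree-resp {suc d} split (degree-+ {suc d} (degree-suc {d} (degree-* {d} a fd)) shifted)
    where
    shifted : Degree< (suc d) λ x → 0# + x * (b * f x)
    shifted = 0# , _ , degree-* {d} b fd , λ x → refl

    split : ∀ x → l x * f x ≈ a * f x + (0# + x * (b * f x))
    split x = begin
      l x * f x                     ≈⟨ *-congʳ (l≈ x) ⟩
      (a + x * l′ x) * f x          ≈⟨ *-congʳ (+-congˡ (*-congˡ (l′≈ x))) ⟩
      (a + x * (b + x * l″ x)) * f x
        ≈⟨ *-congʳ (+-congˡ (*-congˡ (+-congˡ (trans (*-congˡ (l″≈0 x)) (zeroʳ x))))) ⟩
      (a + x * (b + 0#)) * f x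
        ≈⟨ solve 5 (λ a x b o f → (a :+ x :* (b :+ o)) :* f := a :* f :+ (x :* (b :* f) :+ (x :* o) :* f))
             refl a x b 0# (f x) ⟩
      a * f x + (x * (b * f x) + x * 0# * f x)
        ≈⟨ +-congˡ (trans (+-congˡ (trans (*-congʳ (zeroʳ x)) (zeroˡ _))) (+-comm _ _)) ⟩
      a * f x + (0# + x * (b * f x)) ∎

  degree-x-_ : ∀ a → Degree< 2 λ x → x - a
  degree-x- a = degree-+ {2} degree-id (degree-const {1} (- a))

  monic⇒degree : ∀ {d f} → Monic d f → Degree< (suc d) f
  monic⇒degree {zero}  (lift f≈1) = degree-resp {1} f≈1 (degree-const 1#)
  monic⇒degree {suc d} (a , f′ , f′m , f≈) = a , f′ , monic⇒degree {d} f′m , f≈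

  monic-+ : ∀ {d f g} → Monic d f → Degree< d g → Monic d λ x → f x + g x
  monic-+ {zero}  (lift f≈1) (lift g≈0) = lift λ x → trans (+-cong (f≈1 x) (g≈0 x)) (+-identityʳ 1#)
  monic-+ {suc d} (a , f′ , f′m , f≈) (b , g′ , g′d , g≈) =
    a + b , _ , monic-+ {d} f′m g′d , λ x → trans (+-cong (f≈ x) (g≈ x))
      (solve 5 (λ a b x f g → (a :+ x :* f) :+ (b :+ x :* g) := (a :+ b) :+ x :* (f :+ g))
         refl a b x (f′ x) (g′ x))

  monic-difference : ∀ {d f g} → Monic d f → Monic d g → Degree< d λ x → f x - g x
  monic-difference {zero}  (lift f≈1) (lift g≈1) =
    lift λ x → trans (+-cong (f≈1 x) (-‿cong (g≈1 x))) (-‿inverseʳ 1#)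
  monic-difference {suc d} (a , f′ , f′m , f≈) (b , g′ , g′m , g≈) =
    a - b , _ , monic-difference {d} f′m g′m , λ x → trans (+-cong (f≈ x) (-‿cong (g≈ x)))
      (solve 5 (λ a b x f g → (a :+ x :* f) :- (b :+ x :* g) := (a :- b) :+ x :* (f :- g))
         refl a b x (f′ x) (g′ x))

  monic-[x-_]* : ∀ {d f} a → Monic d f → Monic (suc d) λ x → (x - a) * f x
  monic-[x-_]* {d} {f} a fm = monic-resp {suc d} split
    (monic-+ {suc d} (0# , f , fm , λ x → refl) (degree-* {suc d} (- a) (monic⇒degree {d} fm)))
    where
    split : ∀ x → (x - a) * f x ≈ (0# + x * f x) + - a * f x
    split x = trans (distribʳ _ _ _) (+-congʳ (sym (+-identityˡ _)))

  -- Synthetic division by `x - a`: if `h` is the quotient of the tail `g`, then the quotient of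
  -- `b + x * g x` is `g a + x * h x`.
  degree-factor : ∀ {d f} → Degree< (suc d) f → ∀ a →
                  ∃ λ h → Degree< d h × ∀ x → f x ≈ f a + (x - a) * h x
  degree-factor {zero} {f} (b , g , lift g≈0 , f≈) a =
    _ , degree-zero 0 , λ x → trans (f≈ x) (trans (+-congˡ (trans (*-congˡ (g≈0 x)) (zeroʳ x)))
      (sym (trans (+-cong (trans (f≈ a) (+-congˡ (trans (*-congˡ (g≈0 a)) (zeroʳ a)))) (zeroʳ _))
                  (+-identityʳ _))))
  degree-factor {suc d} {f} (b , g , gd , f≈) a with degree-factor {d} gd a
  ... | h , hd , g≈ = _ , (g a , h , hd , λ x → refl) , λ x → begin
    f x                                      ≈⟨ f≈ x ⟩
    b + x * g x                              ≈⟨ +-congˡ (*-congˡ (g≈ x)) ⟩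
    b + x * (g a + (x - a) * h x)
      ≈⟨ solve 5 (λ b x g a h → b :+ x :* (g :+ (x :- a) :* h) :=
           (b :+ a :* g) :+ (x :- a) :* (g :+ x :* h)) refl b x (g a) a (h x) ⟩
    (b + a * g a) + (x - a) * (g a + x * h x) ≈⟨ +-congʳ (f≈ a) ⟨
    f a + (x - a) * (g a + x * h x)          ∎

  monic-factor : ∀ {d f} → Monic (suc d) f → ∀ a →
                 ∃ λ h → Monic d h × ∀ x → f x ≈ f a + (x - a) * h x
  monic-factor {zero} {f} (b , g , lift g≈1 , f≈) a =
    _ , lift (λ x → refl) , λ x → begin
      f x                          ≈⟨ trans (f≈ x) (+-congˡ (*-congˡ (g≈1 x))) ⟩
      b + x * 1#
        ≈⟨ solve 3 (λ b x a → b :+ x :* :1 := (b :+ a :* :1) :+ (x :- a) :* :1) refl b x a ⟩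
      (b + a * 1#) + (x - a) * 1#  ≈⟨ +-congʳ (trans (f≈ a) (+-congˡ (*-congˡ (g≈1 a)))) ⟨
      f a + (x - a) * 1#           ∎
  monic-factor {suc d} {f} (b , g , gm , f≈) a with monic-factor {d} gm a
  ... | h , hm , g≈ = _ , (g a , h , hm , λ x → refl) , λ x → begin
    f x                                      ≈⟨ f≈ x ⟩
    b + x * g x                              ≈⟨ +-congˡ (*-congˡ (g≈ x)) ⟩
    b + x * (g a + (x - a) * h x)
      ≈⟨ solve 5 (λ b x g a h → b :+ x :* (g :+ (x :- a) :* h) :=
           (b :+ a :* g) :+ (x :- a) :* (g :+ x :* h)) refl b x (g a) a (h x) ⟩
    (b + a * g a) + (x - a) * (g a + x * h x) ≈⟨ +-congʳ (f≈ a) ⟨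
    f a + (x - a) * (g a + x * h x)          ∎

  -- Lists the coefficients below the leading one, which is the form in which `root` takes a
  -- polynomial.
  monic-coefficients : ∀ {d f} → Monic d f →
                       ∃ λ (a : Fin d → Carrier) → ∀ x → f x ≈ x ^ d + sum λ i → a i * x ^ toℕ i
  monic-coefficients {zero}  (lift f≈1) = (λ ()) , λ x → trans (f≈1 x) (sym (+-identityʳ 1#))
  monic-coefficients {suc d} {f} (b , g , gm , f≈) with monic-coefficients {d} gm
  ... | a , g≈ = coefficients , λ x → begin
    f x                                              ≈⟨ f≈ x ⟩
    b + x * g x                                      ≈⟨ +-congˡ (*-congˡ (g≈ x)) ⟩
    b + x * (x ^ d + sum λ i → a i * x ^ toℕ i)
      ≈⟨ solve 4 (λ b x p s → b :+ x :* (p :+ s) := x :* p :+ (b :* :1 :+ x :* s)) refl b x (x ^ d) _ ⟩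
    x * x ^ d + (b * 1# + x * sum λ i → a i * x ^ toℕ i)
      ≈⟨ +-congˡ (+-congˡ (trans (*-distribˡ-sum {d} x λ i → a i * x ^ toℕ i)
           (sum-cong-≋ {d} λ i → solve 3 (λ x a p → x :* (a :* p) := a :* (x :* p)) refl x (a i) (x ^ toℕ i)))) ⟩
    x * x ^ d + (b * 1# + sum λ i → a i * (x * x ^ toℕ i)) ∎
    where
    coefficients : Fin (suc d) → Carrier
    coefficients zero    = b
    coefficients (suc i) = a i

  monic-root : ∀ {d f} → Monic (suc d) f → ∃ λ x → f x ≈ 0#
  monic-root {d} fm =
    let a , f≈ = monic-coefficients {suc d} fm
        x , x-root = root {d} a
    in x , trans (f≈ x) x-root

  ∏[_-_] : Carrier → List Carrier → Carrier
  ∏[ x - λs ] = foldr (λ a p → (x - a) * p) 1# λs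

  monic-splits : ∀ {d f} → Monic d f → ∃ λ λs → length λs ≡ d × ∀ x → f x ≈ ∏[ x - λs ]
  monic-splits {zero}  (lift f≈1) = [] , ≡.refl , f≈1
  monic-splits {suc d} {f} fm =
    let a , fa≈0             = monic-root {d} fm
        h , hm , f≈          = monic-factor {d} fm a
        λs , length≡d , h≈   = monic-splits {d} hm
    in a ∷ λs , ≡.cong suc length≡d , λ x → begin
      f x                     ≈⟨ f≈ x ⟩
      f a + (x - a) * h x     ≈⟨ +-cong fa≈0 (*-congˡ (h≈ x)) ⟩
      0# + ∏[ x - (a ∷ λs) ]  ≈⟨ +-identityˡ _ ⟩
      ∏[ x - (a ∷ λs) ]       ∎

  -- Characteristic zero enters here: it makes positive integers apart from zero, hence invertible.
  ·1-cancel : ∀ k a → (suc k · 1#) * a ≈ 0# → a ≈ 0#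
  ·1-cancel k a ka≈0 with #⇒invertible (characteristicZero k)
  ... | y , y*k≈1 , _ = begin
    a                               ≈⟨ *-identityˡ a ⟨
    1# * a                          ≈⟨ *-congʳ y*k≈1 ⟨
    y * ((suc k · 1#) - 0#) * a     ≈⟨ *-congʳ (*-congˡ (trans (+-congˡ -0#≈0#) (+-identityʳ _))) ⟩
    y * (suc k · 1#) * a            ≈⟨ *-assoc _ _ _ ⟩
    y * ((suc k · 1#) * a)          ≈⟨ trans (*-congˡ ka≈0) (zeroʳ y) ⟩
    0#                              ∎

  -- The roots `a + 1`, `a + 2`, ... are explicit, so their distinctness need not be decided. Once
  -- `x - (a + 1)` is divided out, its value at each later root is a positive integer, and the
  -- quotient must vanish there.
  degree-vanishing : ∀ {d f} → Degree< d f → ∀ a → (∀ k → f (a + (suc k · 1#)) ≈ 0#) → ∀ x → f x ≈ 0#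
  degree-vanishing {zero}  (lift f≈0) a f-roots = f≈0
  degree-vanishing {suc d} {f} fd a f-roots with degree-factor {d} fd (a + (1 · 1#))
  ... | h , hd , f≈ = λ x → trans (factorization x)
      (trans (*-congˡ (degree-vanishing {d} hd b h-roots x)) (zeroʳ _))
    where
    b : Carrier
    b = a + (1 · 1#)

    factorization : ∀ x → f x ≈ (x - b) * h x
    factorization x = trans (f≈ x) (trans (+-congʳ (f-roots 0)) (+-identityˡ _))

    h-roots : ∀ k → h (b + (suc k · 1#)) ≈ 0#
    h-roots k = ·1-cancel k _ (begin
      (suc k · 1#) * h (b + (suc k · 1#))
        ≈⟨ *-congʳ (solve 2 (λ b k → k := (b :+ k) :- b) refl b (suc k · 1#)) ⟩
      (b + (suc k · 1#) - b) * h (b + (suc k · 1#))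
        ≈⟨ factorization _ ⟨
      f (b + (suc k · 1#))
        ≈⟨ degree-congruent {suc d} fd (trans (+-assoc _ _ _) (+-congˡ (+-congʳ (+-identityʳ 1#)))) ⟩
      f (a + (suc (suc k) · 1#))
        ≈⟨ f-roots (suc k) ⟩
      0# ∎)

  -- At `a + 1`, `a + 2`, ... the linear factor is a positive integer and can be cancelled; those
  -- zeros force `f` to vanish everywhere, at `a` as well.
  [x-_]-cancel : ∀ {d f} a → Degree< d f → (∀ x → (x - a) * f x ≈ 0#) → ∀ x → f x ≈ 0#
  [x-_]-cancel {d} {f} a fd xf≈0 = degree-vanishing {d} fd a λ k → ·1-cancel k _
    (trans (*-congʳ (solve 2 (λ a k → k := (a :+ k) :- a) refl a (suc k · 1#))) (xf≈0 _))

  -- The zeros of `q` are no exception in the conclusion: `q` splits into linear factors, and each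
  -- is cancelled in turn, with a degree bound for the product still left.
  monic-cancel : ∀ {d e f q} → Monic e q → Degree< d f → (∀ x → q x * f x ≈ 0#) → ∀ x → f x ≈ 0#
  monic-cancel {d} {e} {f} qm fd qf≈0 with monic-splits {e} qm
  ... | λs , _ , q≈ = cancel λs λ x → trans (*-congʳ (sym (q≈ x))) (qf≈0 x)
    where
    degree-∏* : ∀ λs → ∃ λ k → Degree< k λ x → ∏[ x - λs ] * f x
    degree-∏* []       = d , degree-* {d} 1# fd
    degree-∏* (a ∷ λs) with degree-∏* λs
    ... | k , kd = suc k , degree-resp {suc k} (λ x → *-assoc _ _ _) (degree-linear* {k} (degree-x- a) kd)

    cancel : ∀ λs → (∀ x → ∏[ x - λs ] * f x ≈ 0#) → ∀ x → f x ≈ 0#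
    cancel []       f≈0 x = trans (sym (*-identityˡ _)) (f≈0 x)
    cancel (a ∷ λs) f≈0   = cancel λs ([x-_]-cancel {proj₁ (degree-∏* λs)} a (proj₂ (degree-∏* λs))
      λ x → trans (sym (*-assoc _ _ _)) (f≈0 x))

  degree-det : ∀ {n} (M : Carrier → Matrix n) → (∀ i j → Degree< 2 λ x → M x i j) →
               Degree< (suc n) λ x → det (M x)
  degree-det {zero}  M Md = degree-const 1#
  degree-det {suc n} M Md = degree-sum {suc (suc n)} {suc n} λ k →
    degree-linear* {suc n} (degree-* {2} ((- 1#) ^ toℕ k) (Md zero k))
      (degree-det (λ x i j → M x (suc i) (punchIn k j)) λ i j → Md (suc i) (punchIn k j))

  degree-characteristicEntry : ∀ {n} (M : Matrix n) i j → Degree< 2 λ x → scalar x i j - M i j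
  degree-characteristicEntry M i j = degree-+ {2} (degree-if (does (i ≟ j))) (degree-const {1} _)
    where
    degree-if : ∀ b → Degree< 2 λ x → if b then x else 0#
    degree-if true  = degree-id
    degree-if false = degree-zero 2

  -- The corner term is `x - M zero zero` times a monic polynomial of degree `n`. The other entries
  -- of the first row are constant in `x`, so the crude bound `n` on the degree of their minors
  -- suffices.
  monic-characteristicPolynomial : ∀ {n} (M : Matrix n) → Monic n (characteristicPolynomial M)
  monic-characteristicPolynomial {zero}  M = lift λ _ → refl
  monic-characteristicPolynomial {suc n} M =
    monic-+ {suc n}
      (monic-resp {suc n} (λ x → *-congʳ (*-identityˡ _))
        (monic-[x-_]* {n} (M zero zero) (monic-characteristicPolynomial (λ i j → M (suc i) (suc j)))))
      (degree-sum {suc n} {n} λ k → degree-* {suc n} ((- 1#) ^ suc (toℕ k) * (0# - M zero (suc k)))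
        (degree-det (λ x i j → scalar x (suc i) (punchIn (suc k) j) - M (suc i) (punchIn (suc k) j))
          λ i j → degree-characteristicEntry M (suc i) (punchIn (suc k) j)))

-- Vertex degrees and isomorphisms of the joins.

module GraphCount where

  open import Algebra.Properties.CommutativeMonoid.Sum ℕ.+-0-commutativeMonoid
    using (sum; sum-cong-≗; sum-permute; ∑-distrib-+)
  open ≡ using (refl; sym; trans; cong; cong₂; subst; module ≡-Reasoning)
  open FiniteSum ℕ.+-0-commutativeMonoid

  count : ∀ {n} → (Fin n → Bool) → ℕ
  count b = ∣ tabulate b ∣

  indicator : Bool → ℕ
  indicator b = if b then 1 else 0

  count-sum : ∀ {n} (b : Fin n → Bool) → count b ≡ sum (indicator ∘ b)
  count-sum {zero}  b = refl
  count-sum {suc n} b with b zero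
  ... | true  = cong suc (count-sum (b ∘ suc))
  ... | false = count-sum (b ∘ suc)

  count-cong : ∀ {n} {b c : Fin n → Bool} → (∀ i → b i ≡ c i) → count b ≡ count c
  count-cong b≗c = cong ∣_∣ (tabulate-cong b≗c)

  count-permute : ∀ {m n} (π : Fin m ↔ Fin n) (b : Fin n → Bool) → count (b ∘ Inverse.to π) ≡ count b
  count-permute {m} {n} π b = begin
    count (b ∘ Inverse.to π)              ≡⟨ count-sum (b ∘ Inverse.to π) ⟩
    sum (indicator ∘ b ∘ Inverse.to π)    ≡⟨ sum-permute (indicator ∘ b) π ⟨
    sum (indicator ∘ b)                   ≡⟨ count-sum b ⟨
    count b                               ∎
    where open ≡-Reasoning

  count-false : ∀ {n} (b : Fin n → Bool) → count b ≡ 0 → ∀ i → b i ≡ false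
  count-false {suc n} b eq i with b zero in b₀
  count-false {suc n} b eq zero    | false = b₀
  count-false {suc n} b eq (suc i) | false = count-false (b ∘ suc) eq i

  count-positive : ∀ {n} (b : Fin n → Bool) → 0 < count b → ∃ λ i → b i ≡ true
  count-positive {suc n} b pos with b zero in b₀
  ... | true  = zero , b₀
  ... | false = let i , bᵢ = count-positive (b ∘ suc) pos in suc i , bᵢ

  sum-one : ∀ n → sum {n} (λ _ → 1) ≡ n
  sum-one zero    = refl
  sum-one (suc n) = cong suc (sum-one n)

  nonNeighbour : ∀ {n} → Graph n → Fin n → Fin n → Bool
  nonNeighbour F i j = not (does (i ≟ j)) ∧ not (adj F i j)

  does-sym : ∀ {n} (i j : Fin n) → does (i ≟ j) ≡ does (j ≟ i)
  does-sym zero    zero    = refl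
  does-sym zero    (suc j) = refl
  does-sym (suc i) zero    = refl
  does-sym (suc i) (suc j) = does-sym i j

  does-adj : ∀ {n} (F : Graph n) i j → does (i ≟ j) ≡ true → adj F i j ≡ false
  does-adj F i j eq with i ≟ j
  does-adj F i i eq | yes refl = Graph.irrefl F i

  nonNeighbour-sym : ∀ {n} (F : Graph n) i j → nonNeighbour F i j ≡ nonNeighbour F j i
  nonNeighbour-sym F i j = cong₂ (λ a b → not a ∧ not b) (does-sym i j) (Graph.sym F i j)

  nonNeighbour-count : ∀ {n} (F : Graph n) i → suc (degree F i ℕ.+ count (nonNeighbour F i)) ≡ n
  nonNeighbour-count {n} F i = begin
    suc (count (adj F i) ℕ.+ count (nonNeighbour F i))
      ≡⟨ cong₂ ℕ._+_ (sym (sum-ifˡ i λ _ → 1)) (cong₂ ℕ._+_ (count-sum (adj F i)) (count-sum (nonNeighbour F i))) ⟩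
    sum equal ℕ.+ (sum adjacent ℕ.+ sum apart)
      ≡⟨ cong (sum equal ℕ.+_) (∑-distrib-+ adjacent apart) ⟨
    sum equal ℕ.+ sum (λ j → adjacent j ℕ.+ apart j)
      ≡⟨ ∑-distrib-+ equal (λ j → adjacent j ℕ.+ apart j) ⟨
    sum (λ j → equal j ℕ.+ (adjacent j ℕ.+ apart j))
      ≡⟨ sum-cong-≗ (λ j → exactlyOne (does (i ≟ j)) (adj F i j) (does-adj F i j)) ⟩
    sum {n} (λ _ → 1)
      ≡⟨ sum-one n ⟩
    n ∎
    where
    open ≡-Reasoning
    equal adjacent apart : Fin n → ℕ
    equal j    = indicator (does (i ≟ j))
    adjacent j = indicator (adj F i j)
    apart j    = indicator (nonNeighbour F i j)

    exactlyOne : ∀ a b → (a ≡ true → b ≡ false) →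
                 indicator a ℕ.+ (indicator b ℕ.+ indicator (not a ∧ not b)) ≡ 1
    exactlyOne true  true  a⇒¬b with () ← a⇒¬b refl
    exactlyOne true  false _ = refl
    exactlyOne false true  _ = refl
    exactlyOne false false _ = refl

  -- Treats both joins at once: `s` is `r` for adjacency and `n ∸ suc r` for non-adjacency of
  -- distinct vertices.
  record LinkRegular {n} (s : ℕ) (link : Fin n → Fin n → Bool) : Set where
    field
      link-sym    : ∀ i j → link i j ≡ link j i
      link-degree : ∀ i → count (link i) ≡ s
  open LinkRegular public

  joinDegree : ∀ {n m} → ℕ → ℕ → Graph m → JoinVertex n m → ℕ
  joinDegree {n} {m} r s G (u _)  = r ℕ.+ (s ℕ.+ m)
  joinDegree {n} {m} r s G (u′ _) = s
  joinDegree {n} {m} r s G (v j)  = n ℕ.+ degree G j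

  module _ {n m r s} {link : Fin n → Fin n → Bool} {F : Graph n} (G : Graph m)
           (F-regular : Regular r F) (link-regular : LinkRegular s link) where

    private
      joinCount : ∀ x → sum (λ k → indicator (joinAdj link F G x (joinVertex n m k))) ≡ joinDegree r s G x
      joinCount x = trans (sum-joinVertex {n} {m} (indicator ∘ joinAdj link F G x)) (parts x)
        where
        parts : ∀ x → sum (indicator ∘ joinAdj link F G x ∘ u) ℕ.+ (sum (indicator ∘ joinAdj link F G x ∘ u′) ℕ.+
                      sum (indicator ∘ joinAdj link F G x ∘ v)) ≡ joinDegree r s G x
        parts (u i)  = cong₂ ℕ._+_ (trans (sym (count-sum (adj F i))) (F-regular i))
          (cong₂ ℕ._+_ (trans (sum-cong-≗ λ j → cong indicator (link-sym link-regular j i))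
                              (trans (sym (count-sum (link i))) (link-degree link-regular i)))
                       (sum-one m))
        parts (u′ i) = trans (cong₂ ℕ._+_ (trans (sym (count-sum (link i))) (link-degree link-regular i))
          (cong₂ ℕ._+_ (sum-zero {n} {f = λ _ → 0} λ _ → refl) (sum-zero {m} {f = λ _ → 0} λ _ → refl))) (ℕ.+-identityʳ s)
        parts (v j)  = cong₂ ℕ._+_ (sum-one n)
          (cong₂ ℕ._+_ (sum-zero {n} {f = λ _ → 0} λ _ → refl) (sym (count-sum (adj G j))))

    degree-join : ∀ k → degree (splittingJoin link F G) k ≡ joinDegree r s G (joinVertex n m k)
    degree-join k = trans (count-sum (adj (splittingJoin link F G) k)) (joinCount (joinVertex n m k))

  vertexIndex : ∀ n m → JoinVertex n m → Fin (n ℕ.+ (n ℕ.+ m))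
  vertexIndex n m (u i)  = i ↑ˡ (n ℕ.+ m)
  vertexIndex n m (u′ i) = n ↑ʳ (i ↑ˡ m)
  vertexIndex n m (v j)  = n ↑ʳ (n ↑ʳ j)

  joinVertex-vertexIndex : ∀ n m x → joinVertex n m (vertexIndex n m x) ≡ x
  joinVertex-vertexIndex n m (u i)  rewrite splitAt-↑ˡ n i (n ℕ.+ m) = refl
  joinVertex-vertexIndex n m (u′ i) rewrite splitAt-↑ʳ n (n ℕ.+ m) (i ↑ˡ m) | splitAt-↑ˡ n i m = refl
  joinVertex-vertexIndex n m (v j)  rewrite splitAt-↑ʳ n (n ℕ.+ m) (n ↑ʳ j) | splitAt-↑ʳ n m j = refl

  vertexIndex-joinVertex : ∀ n m k → vertexIndex n m (joinVertex n m k) ≡ k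
  vertexIndex-joinVertex n m k with splitAt n k in eq
  ... | inj₁ i = splitAt⁻¹-↑ˡ eq
  ... | inj₂ l with splitAt n l in eq′
  ...   | inj₁ i = trans (cong (n ↑ʳ_) (splitAt⁻¹-↑ˡ eq′)) (splitAt⁻¹-↑ʳ eq)
  ...   | inj₂ j = trans (cong (n ↑ʳ_) (splitAt⁻¹-↑ʳ eq′)) (splitAt⁻¹-↑ʳ eq)

  ≅-degree : ∀ {m n} {G : Graph m} {H : Graph n} ((π , _) : G ≅ H) → ∀ i → degree G i ≡ degree H (Inverse.to π i)
  ≅-degree {H = H} (π , π-adj) i = trans (count-cong (π-adj i)) (count-permute π (adj H (Inverse.to π i)))

  ≅-sym : ∀ {m n} {G : Graph m} {H : Graph n} → G ≅ H → H ≅ G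
  ≅-sym {H = H} (π , π-adj) = mk↔ₛ′ from to strictlyInverseʳ strictlyInverseˡ ,
    λ i j → trans (cong₂ (adj H) (sym (strictlyInverseˡ i)) (sym (strictlyInverseˡ j))) (sym (π-adj (from i) (from j)))
    where open Inverse π

  -- In both joins the vertices u′ are those of degree s, and the vertices u are
  -- those with a neighbour of degree s.
  module _ {n m r s} {link link′ : Fin n → Fin n → Bool} {F H : Graph n} {G : Graph m}
           (F-regular : Regular r F) (H-regular : Regular r H)
           (link-regular : LinkRegular s link) (link′-regular : LinkRegular s link′)
           (0<r : 0 < r) (0<s : 0 < s) (s<n : s < n)
           (iso : splittingJoin link F G ≅ splittingJoin link′ H G) where

    private
      image : JoinVertex n m → JoinVertex n m
      image x = joinVertex n m (Inverse.to (proj₁ iso) (vertexIndex n m x))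

      image-degree : ∀ x → joinDegree r s G x ≡ joinDegree r s G (image x)
      image-degree x = begin
        joinDegree r s G x
          ≡⟨ cong (joinDegree r s G) (joinVertex-vertexIndex n m x) ⟨
        joinDegree r s G (joinVertex n m (vertexIndex n m x))
          ≡⟨ degree-join {link = link} {F} G F-regular link-regular (vertexIndex n m x) ⟨
        degree (splittingJoin link F G) (vertexIndex n m x)
          ≡⟨ ≅-degree {G = splittingJoin link F G} {splittingJoin link′ H G} iso (vertexIndex n m x) ⟩
        degree (splittingJoin link′ H G) (Inverse.to (proj₁ iso) (vertexIndex n m x))
          ≡⟨ degree-join {link = link′} {H} G H-regular link′-regular _ ⟩
        joinDegree r s G (image x) ∎
        where open ≡-Reasoning

      image-adj′ : ∀ x y → joinAdj link F G x y ≡ joinAdj link′ H G (image x) (image y)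
      image-adj′ x y = trans
        (cong₂ (joinAdj link F G) (sym (joinVertex-vertexIndex n m x)) (sym (joinVertex-vertexIndex n m y)))
        (proj₂ iso (vertexIndex n m x) (vertexIndex n m y))

      -- `0 < r` keeps the degree `r + (s + m)` of a u vertex above `s`; `s < n` does so for a v
      -- vertex, which is joined to all `n` of the u vertices.
      isU′ : ∀ x → joinDegree r s G x ≡ s → ∃ λ i → x ≡ u′ i
      isU′ (u i)  eq = ⊥-elim (ℕ.<⇒≢ (ℕ.<-≤-trans (ℕ.+-monoˡ-< s 0<r)
        (ℕ.+-monoʳ-≤ r (ℕ.m≤m+n s m))) (sym eq))
      isU′ (u′ i) eq = i , refl
      isU′ (v j)  eq = ⊥-elim (ℕ.<⇒≢ (ℕ.<-≤-trans s<n (ℕ.m≤m+n n _)) (sym eq))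

      adjacentToU′ : ∀ x j → joinAdj link′ H G x (u′ j) ≡ true → ∃ λ i → x ≡ u i
      adjacentToU′ (u i) j eq = i , refl

      image-u : ∀ i → ∃ λ j → image (u i) ≡ u j
      image-u i =
        -- `0 < s` provides a u′ neighbour of `u i`, and equality of degrees sends it to a u′
        -- vertex.
        let j , linked = count-positive (link i) (subst (0 <_) (sym (link-degree link-regular i)) 0<s)
            k , image≡ = isU′ (image (u′ j)) (sym (image-degree (u′ j)))
        in adjacentToU′ (image (u i)) k (trans (cong (joinAdj link′ H G (image (u i))) (sym image≡))
             (trans (sym (image-adj′ (u i) (u′ j))) (trans (link-sym link-regular j i) linked)))

    uImage : Fin n → Fin n
    uImage i = proj₁ (image-u i)

    vertexIndex-uImage : ∀ i → Inverse.to (proj₁ iso) (vertexIndex n m (u i)) ≡ vertexIndex n m (u (uImage i))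
    vertexIndex-uImage i = trans (sym (vertexIndex-joinVertex n m _)) (cong (vertexIndex n m) (proj₂ (image-u i)))

    uImage-adj : ∀ i j → adj F i j ≡ adj H (uImage i) (uImage j)
    uImage-adj i j = trans (image-adj′ (u i) (u j))
      (cong₂ (joinAdj link′ H G) (proj₂ (image-u i)) (proj₂ (image-u j)))

  u-injective : ∀ {n m} {i j : Fin n} → u {n} {m} i ≡ u j → i ≡ j
  u-injective refl = refl

  -- The isomorphism and its inverse each restrict to the u vertices. The restrictions are mutually
  -- inverse because the full maps are and `index` is injective.
  splittingJoin-cancel : ∀ {n m r s} {link link′ : Fin n → Fin n → Bool} {F H : Graph n} (G : Graph m) →
    Regular r F → Regular r H → LinkRegular s link → LinkRegular s link′ → 0 < r → 0 < s → s < n →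
    splittingJoin link F G ≅ splittingJoin link′ H G → F ≅ H
  splittingJoin-cancel {n} {m} {link = link} {link′} {F} {H} G F-regular H-regular link-regular link′-regular 0<r 0<s s<n iso =
    mk↔ₛ′ to from (λ i → injective (to-from i)) (λ i → injective (from-to i)) ,
    uImage-adj {F = F} {H} {G} F-regular H-regular link-regular link′-regular 0<r 0<s s<n iso
    where
    iso⁻¹ : splittingJoin link′ H G ≅ splittingJoin link F G
    iso⁻¹ = ≅-sym {G = splittingJoin link F G} {splittingJoin link′ H G} iso

    to from : Fin n → Fin n
    to   = uImage {F = F} {H} {G} F-regular H-regular link-regular link′-regular 0<r 0<s s<n iso
    from = uImage {F = H} {F} {G} H-regular F-regular link′-regular link-regular 0<r 0<s s<n iso⁻¹

    index : Fin n → Fin (n ℕ.+ (n ℕ.+ m))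
    index = vertexIndex n m ∘ u

    injective : ∀ {i j} → index i ≡ index j → i ≡ j
    injective eq = u-injective (trans (sym (joinVertex-vertexIndex n m (u _)))
      (trans (cong (joinVertex n m) eq) (joinVertex-vertexIndex n m (u _))))

    index-to : ∀ i → Inverse.to (proj₁ iso) (index i) ≡ index (to i)
    index-to = vertexIndex-uImage {F = F} {H} {G} F-regular H-regular link-regular link′-regular 0<r 0<s s<n iso

    index-from : ∀ i → Inverse.from (proj₁ iso) (index i) ≡ index (from i)
    index-from = vertexIndex-uImage {F = H} {F} {G} H-regular F-regular link′-regular link-regular 0<r 0<s s<n iso⁻¹

    to-from : ∀ i → index (to (from i)) ≡ index i
    to-from i = trans (sym (index-to (from i))) (trans (cong (Inverse.to (proj₁ iso)) (sym (index-from i)))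
      (Inverse.strictlyInverseˡ (proj₁ iso) (index i)))

    from-to : ∀ i → index (from (to i)) ≡ index i
    from-to i = trans (sym (index-from (to i))) (trans (cong (Inverse.from (proj₁ iso)) (sym (index-to i)))
      (Inverse.strictlyInverseʳ (proj₁ iso) (index i)))

  adj≗⇒≅ : ∀ {n} {F H : Graph n} → (∀ i j → adj F i j ≡ adj H i j) → F ≅ H
  adj≗⇒≅ eq = ↔-id _ , eq

  adj-linkRegular : ∀ {n r} {F : Graph n} → Regular r F → LinkRegular r (adj F)
  adj-linkRegular {F = F} F-regular = record { link-sym = Graph.sym F ; link-degree = F-regular }

  nonNeighbour-linkRegular : ∀ {n r} {F : Graph n} → Regular r F → LinkRegular (n ℕ.∸ suc r) (nonNeighbour F)
  nonNeighbour-linkRegular {n} {r} {F} F-regular = record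
    { link-sym    = nonNeighbour-sym F
    ; link-degree = λ i → begin
        count (nonNeighbour F i)                                      ≡⟨ ℕ.m+n∸m≡n (suc r) _ ⟨
        suc (r ℕ.+ count (nonNeighbour F i)) ℕ.∸ suc r
          ≡⟨ cong (λ d → suc (d ℕ.+ count (nonNeighbour F i)) ℕ.∸ suc r) (F-regular i) ⟨
        suc (degree F i ℕ.+ count (nonNeighbour F i)) ℕ.∸ suc r       ≡⟨ cong (ℕ._∸ suc r) (nonNeighbour-count F i) ⟩
        n ℕ.∸ suc r                                                   ∎
    }
    where open ≡-Reasoning

  nonNeighbour-false : ∀ {n} {F : Graph n} → (∀ i j → nonNeighbour F i j ≡ false) →
                       ∀ i j → adj F i j ≡ not (does (i ≟ j))
  nonNeighbour-false {F = F} none i j = cases (does (i ≟ j)) (adj F i j) (does-adj F i j) (none i j)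
    where
    cases : ∀ a b → (a ≡ true → b ≡ false) → not a ∧ not b ≡ false → b ≡ not a
    cases true  b     a⇒¬b eq = a⇒¬b refl
    cases false true  a⇒¬b eq = refl

  module _ {n m r} {F H : Graph n} (G : Graph m) (F-regular : Regular r F) (H-regular : Regular r H)
           (F≇H : ¬ (F ≅ H)) where

    private
      -- With `r = 0` both graphs would be edgeless on the same vertex set.
      0<r : 0 < r
      0<r = ℕ.n≢0⇒n>0 λ r≡0 → F≇H (adj≗⇒≅ {F = F} {H} λ i j →
        trans (count-false (adj F i) (trans (F-regular i) r≡0) j)
              (sym (count-false (adj H i) (trans (H-regular i) r≡0) j)))

      0<n : 0 < n
      0<n = ℕ.n≢0⇒n>0 λ { refl → F≇H (adj≗⇒≅ {F = F} {H} λ ()) }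

      -- Some vertex exists by `0<n`, and it is not among its own `r` neighbours.
      r<n : r < n
      r<n = bound 0<n F F-regular
        where
        bound : ∀ {n} → 0 < n → (F : Graph n) → Regular r F → r < n
        bound {suc n} _ F F-regular = subst (r <_) (nonNeighbour-count F zero)
          (s≤s (subst (r ℕ.≤_) (cong (ℕ._+ count (nonNeighbour F zero)) (sym (F-regular zero))) (ℕ.m≤m+n r _)))

      -- With no non-neighbours both graphs would be complete.
      0<n∸1∸r : 0 < n ℕ.∸ suc r
      0<n∸1∸r = ℕ.n≢0⇒n>0 λ s≡0 → F≇H (adj≗⇒≅ {F = F} {H} λ i j →
        trans (nonNeighbour-false {F = F} (complete F F-regular s≡0) i j)
              (sym (nonNeighbour-false {F = H} (complete H H-regular s≡0) i j)))
        where
        complete : ∀ F → Regular r F → n ℕ.∸ suc r ≡ 0 → ∀ i j → nonNeighbour F i j ≡ false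
        complete F F-regular s≡0 i = count-false (nonNeighbour F i)
          (trans (link-degree (nonNeighbour-linkRegular {F = F} F-regular) i) s≡0)

    ⊻-≇ : ¬ (F ⊻ G ≅ H ⊻ G)
    ⊻-≇ iso = F≇H (splittingJoin-cancel {F = F} {H} G F-regular H-regular
      (adj-linkRegular {F = F} F-regular) (adj-linkRegular {F = H} H-regular) 0<r 0<r r<n iso)

    ⩣-≇ : ¬ (F ⩣ G ≅ H ⩣ G)
    ⩣-≇ iso = F≇H (splittingJoin-cancel {F = F} {H} G F-regular H-regular
      (nonNeighbour-linkRegular {F = F} F-regular) (nonNeighbour-linkRegular {F = H} H-regular) 0<r 0<n∸1∸r
      -- `s < n` in the form `n ∸ suc r < n ∸ 0`.
      (ℕ.∸-monoʳ-< (ℕ.s≤s (ℕ.z≤n {r})) r<n) iso)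

open GraphCount

-- Cospectrality of the joins.

module SplittingJoinSpectrum {c ℓ₁ ℓ₂} (K : AlgebraicallyClosedCharZeroField c ℓ₁ ℓ₂) where

  open Determinant K
  open Block K
  open PolynomialFunction K
  open AlgebraicallyClosedCharZeroField K using (commutativeRing; _·_)
  open CommutativeRing commutativeRing hiding (zero)
  open import Algebra.Properties.Semiring.Sum semiring
  open import Algebra.Properties.Semiring.Exp semiring using (_^_)
  open import Algebra.Properties.Ring ring using (-0#≈0#)
  open import Relation.Binary.Reasoning.Setoid setoid
  open IntegerSolver commutativeRing
  open Spectra K

  linkMatrix : ∀ {n} → (Fin n → Fin n → Bool) → Matrix n
  linkMatrix link i j = if link i j then 1# else 0#

  sum-count : ∀ {n} (b : Fin n → Bool) → sum (λ j → if b j then 1# else 0#) ≈ count b · 1#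
  sum-count {zero}  b = refl
  sum-count {suc n} b with b zero
  ... | true  = +-congˡ (sum-count (b ∘ suc))
  ... | false = trans (+-identityˡ _) (sum-count (b ∘ suc))

  adjacency-rowSum : ∀ {n r} {F : Graph n} → Regular r F → ∀ i → sum (adjacency F i) ≈ r · 1#
  adjacency-rowSum {F = F} F-regular i = trans (sum-count (adj F i)) (reflexive (≡.cong (_· 1#) (F-regular i)))

  -- The hypothesis of `det-joinMatrix` on the squared link matrix. With the constants as record
  -- parameters, a proof determines them and they can be left implicit.
  record SquareRelation {n} (F : Graph n) (link : Fin n → Fin n → Bool) (β γ κ : Carrier) : Set ℓ₁ where
    field
      square : ∀ i j → (linkMatrix link ⊗ linkMatrix link) i j ≈
               (adjacency F ⊗ adjacency F) i j + β * adjacency F i j + γ * 𝟙 i j + κ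
  open SquareRelation

  adj-square : ∀ {n} (F : Graph n) → SquareRelation F (adj F) 0# 0# 0#
  adj-square F = record
    { square = λ i j → sym (trans (+-identityʳ _) (trans (+-congˡ (zeroˡ (𝟙 i j))) (trans (+-identityʳ _)
        (trans (+-congˡ (zeroˡ (adjacency F i j))) (+-identityʳ _))))) }

  -- (J - I - A)² = A² + 2A + I + (n - 2 - 2r) J
  nonNeighbour-square : ∀ {n r} {F : Graph n} → Regular r F →
    SquareRelation F (nonNeighbour F) (1# + 1#) 1# (((n ℕ.∸ suc r) · 1#) - 1# - (r · 1#))
  nonNeighbour-square {n} {r} {F} F-regular = record { square = λ i j → begin
      -- Only the second factor is expanded, as `J - I - A`. Of the coefficient `ω - 1 - ρ` of `J`,
      -- `ω` comes from `W J`, `- 1` from `- W`, and `- ρ` from `- W A`.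
      sum (λ k → W i k * W k j)
        ≈⟨ sum-cong-≋ {n} (λ k → trans (*-congˡ (W-entry k j)) (solve 3 (λ w δ a → w :* (:1 :- δ :- a) :=
             w :+ (:- w :* δ :+ :- w :* a)) refl (W i k) (𝟙 k j) (B k j))) ⟩
      sum (λ k → W i k + (- W i k * 𝟙 k j + - W i k * B k j))
        ≈⟨ trans (∑-distrib-+ (W i) λ k → - W i k * 𝟙 k j + - W i k * B k j)
             (+-congˡ (∑-distrib-+ (λ k → - W i k * 𝟙 k j) λ k → - W i k * B k j)) ⟩
      sum (W i) + (sum (λ k → - W i k * 𝟙 k j) + sum (λ k → - W i k * B k j))
        ≈⟨ +-cong W-rowSum (+-cong (trans (sum-diagonalʳ (λ _ → 1#) j λ k → - W i k)
             (trans (*-identityʳ _) (-‿cong (W-entry i j)))) (-WB i j)) ⟩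
      ω + (- (1# - 𝟙 i j - B i j) + ((B i j + (B ⊗ B) i j) - ρ))
        ≈⟨ solve 5 (λ ω δ a b ρ → ω :+ (:- (:1 :- δ :- a) :+ ((a :+ b) :- ρ)) :=
             b :+ (:1 :+ :1) :* a :+ :1 :* δ :+ (ω :- :1 :- ρ)) refl ω (𝟙 i j) (B i j) ((B ⊗ B) i j) ρ ⟩
      (B ⊗ B) i j + (1# + 1#) * B i j + 1# * 𝟙 i j + (ω - 1# - ρ) ∎ }
    where
    ω ρ : Carrier
    ω = (n ℕ.∸ suc r) · 1#
    ρ = r · 1#

    W B : Matrix n
    W = linkMatrix (nonNeighbour F)
    B = adjacency F

    W-entry : ∀ i j → W i j ≈ 1# - 𝟙 i j - B i j
    W-entry i j = entry (does (i ≟ j)) (adj F i j) (does-adj F i j)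
      where
      entry : ∀ a b → (a ≡ true → b ≡ false) → (if not a ∧ not b then 1# else 0#) ≈
              1# - (if a then 1# else 0#) - (if b then 1# else 0#)
      entry true  true  a⇒¬b with () ← a⇒¬b ≡.refl
      entry true  false _ = sym (trans (+-cong (-‿inverseʳ 1#) -0#≈0#) (+-identityˡ 0#))
      entry false true  _ = sym (trans (+-congʳ (trans (+-congˡ -0#≈0#) (+-identityʳ 1#))) (-‿inverseʳ 1#))
      entry false false _ = sym (trans (+-cong (trans (+-congˡ -0#≈0#) (+-identityʳ 1#)) -0#≈0#) (+-identityʳ 1#))

    W-rowSum : ∀ {i} → sum (W i) ≈ ω
    W-rowSum {i} = trans (sum-count (nonNeighbour F i))
      (reflexive (≡.cong (_· 1#) (link-degree (nonNeighbour-linkRegular {F = F} F-regular) i)))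

    B-columnSum : ∀ j → sum (λ k → B k j) ≈ ρ
    B-columnSum j = trans (sum-cong-≋ {n} λ k → reflexive (≡.cong (λ b → if b then 1# else 0#) (Graph.sym F k j)))
      (adjacency-rowSum {F = F} F-regular j)

    -WB : ∀ i j → sum (λ k → - W i k * B k j) ≈ (B i j + (B ⊗ B) i j) - ρ
    -WB i j = begin
      sum (λ k → - W i k * B k j)
        ≈⟨ sum-cong-≋ {n} (λ k → trans (*-congʳ (-‿cong (W-entry i k))) (solve 3 (λ δ a b →
             :- (:1 :- δ :- a) :* b := (δ :* b :+ a :* b) :+ (:- :1) :* b) refl (𝟙 i k) (B i k) (B k j))) ⟩
      sum (λ k → (𝟙 i k * B k j + B i k * B k j) + - 1# * B k j)
        ≈⟨ trans (∑-distrib-+ (λ k → 𝟙 i k * B k j + B i k * B k j) λ k → - 1# * B k j)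
             (+-cong (∑-distrib-+ (λ k → 𝟙 i k * B k j) λ k → B i k * B k j)
                     (sym (*-distribˡ-sum {n} (- 1#) λ k → B k j))) ⟩
      (sum (λ k → 𝟙 i k * B k j) + (B ⊗ B) i j) + - 1# * sum (λ k → B k j)
        ≈⟨ +-cong (+-congʳ (trans (sum-diagonalˡ (λ _ → 1#) i λ k → B k j) (*-identityˡ _)))
             (trans (*-congˡ (B-columnSum j)) (solve 1 (λ x → (:- :1) :* x := :- x) refl ρ)) ⟩
      (B i j + (B ⊗ B) i j) - ρ ∎

  -- Every xI - X(G) has the form diag(x - δ deg) + ε A(G).
  δ ε : MatrixType → Carrier
  δ A = 0#
  δ L = 1#
  δ Q = 1#
  ε A = - 1#
  ε L = 1#
  ε Q = - 1#

  ε² : ∀ X → ε X * ε X ≈ 1#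
  ε² A = solve 0 ((:- :1) :* (:- :1) := :1) refl
  ε² L = *-identityˡ 1#
  ε² Q = solve 0 ((:- :1) :* (:- :1) := :1) refl

  characteristicEntry : ∀ X {n} (G : Graph n) x i j → scalar x i j - matrix X G i j ≈
    diagonal (λ k → x - δ X * (degree G k · 1#)) i j + ε X * adjacency G i j
  characteristicEntry A G x i j with does (i ≟ j)
  ... | true  = +-cong (sym (trans (+-congˡ (trans (-‿cong (zeroˡ _)) -0#≈0#)) (+-identityʳ x)))
                       (solve 1 (λ a → :- a := (:- :1) :* a) refl _)
  ... | false = +-congˡ (solve 1 (λ a → :- a := (:- :1) :* a) refl _)
  characteristicEntry L G x i j with does (i ≟ j)
  ... | true  = solve 3 (λ x d a → x :- (d :- a) := (x :- :1 :* d) :+ :1 :* a) refl x _ _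
  ... | false = trans (solve 2 (λ o a → o :- (o :- a) := :1 :* a) refl 0# _) (sym (+-identityˡ _))
  characteristicEntry Q G x i j with does (i ≟ j)
  ... | true  = solve 3 (λ x d a → x :- (d :+ a) := (x :- :1 :* d) :+ (:- :1) :* a) refl x _ _
  ... | false = trans (solve 2 (λ o a → o :- (o :+ a) := (:- :1) :* a) refl 0# _) (sym (+-identityˡ _))

  diagonal-cong : ∀ {n} {d e : Row n} → d ≋ e → ∀ i j → diagonal d i j ≈ diagonal e i j
  diagonal-cong d≋e i j with does (i ≟ j)
  ... | true  = d≋e i
  ... | false = refl

  module _ {n m : ℕ} where

    open JoinDeterminant K n m

    joinDiagonal : (JoinVertex n m → Carrier) → JoinMatrix
    joinDiagonal d (u i)  (u j)  = diagonal (d ∘ u) i j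
    joinDiagonal d (u i)  (u′ j) = 0#
    joinDiagonal d (u i)  (v j)  = 0#
    joinDiagonal d (u′ i) (u j)  = 0#
    joinDiagonal d (u′ i) (u′ j) = diagonal (d ∘ u′) i j
    joinDiagonal d (u′ i) (v j)  = 0#
    joinDiagonal d (v i)  (u j)  = 0#
    joinDiagonal d (v i)  (u′ j) = 0#
    joinDiagonal d (v i)  (v j)  = diagonal (d ∘ v) i j

    diagonal-joinVertex : ∀ d → diagonal (d ∘ joinVertex n m) ≋₂ ⟪ joinDiagonal d ⟫
    diagonal-joinVertex d i j = trans (diagonal-splitAt {n} (d ∘ vertex) i j) (entry (splitAt n i) (splitAt n j))
      where
      rest : Fin n ⊎ Fin m → JoinVertex n m
      rest = [ u′ , v ]′

      vertex : Fin n ⊎ Fin (n ℕ.+ m) → JoinVertex n m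
      vertex = [ u , rest ∘ splitAt n ]′

      corner : ∀ x y → block (diagonal (d ∘ u′)) (λ _ _ → 0#) (λ _ _ → 0#) (diagonal (d ∘ v)) x y ≈
                       joinDiagonal d (rest x) (rest y)
      corner (inj₁ _) (inj₁ _) = refl
      corner (inj₁ _) (inj₂ _) = refl
      corner (inj₂ _) (inj₁ _) = refl
      corner (inj₂ _) (inj₂ _) = refl

      entry : ∀ x y → block (diagonal (d ∘ u)) (λ _ _ → 0#) (λ _ _ → 0#) (diagonal (d ∘ rest ∘ splitAt n)) x y ≈
                      joinDiagonal d (vertex x) (vertex y)
      entry (inj₁ _) (inj₁ _) = refl
      entry (inj₁ _) (inj₂ l) with splitAt n l
      ... | inj₁ _ = refl
      ... | inj₂ _ = refl
      entry (inj₂ k) (inj₁ _) with splitAt n k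
      ... | inj₁ _ = refl
      ... | inj₂ _ = refl
      entry (inj₂ k) (inj₂ l) = trans (diagonal-splitAt {n} (d ∘ rest) k l) (corner (splitAt n k) (splitAt n l))

    module _ (X : MatrixType) (r s : ℕ) (G : Graph m) where

      diagonalEntry : Carrier → JoinVertex n m → Carrier
      diagonalEntry x p = x - δ X * (joinDegree r s G p · 1#)

      -- The diagonal entries at the u and at the u′ vertices, where the degrees are constant.
      σ μ : Carrier → Carrier
      σ x = x - δ X * ((r ℕ.+ (s ℕ.+ m)) · 1#)
      μ x = x - δ X * (s · 1#)

      corner : Carrier → Matrix m
      corner x i j = diagonal (diagonalEntry x ∘ v) i j + ε X * adjacency G i j

      characteristicPolynomial-join : ∀ {F : Graph n} {link} → Regular r F → LinkRegular s link → ∀ x →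
        characteristicPolynomial (matrix X (splittingJoin link F G)) x ≈
        det ⟪ joinMatrix (λ i j → scalar (σ x) i j + ε X * adjacency F i j) (λ i j → ε X * linkMatrix link i j)
                         (μ x) (ε X) (ε X) (corner x) ⟫
      characteristicPolynomial-join {F} {link} F-regular link-regular x =
        det-cong λ i j → trans (characteristicEntry X (splittingJoin link F G) x i j)
          (trans (+-congʳ (trans (diagonal-cong (λ k → +-congˡ (-‿cong (*-congˡ (reflexive (≡.cong (_· 1#)
                    (degree-join {link = link} {F} G F-regular link-regular k)))))) i j)
                    (diagonal-joinVertex (diagonalEntry x) i j)))
                 (entry (joinVertex n m i) (joinVertex n m j)))
        where
        0+e*1 : 0# + ε X * 1# ≈ ε X
        0+e*1 = trans (+-identityˡ _) (*-identityʳ _)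

        a+e*0 : ∀ a → a + ε X * 0# ≈ a
        a+e*0 a = trans (+-congˡ (zeroʳ _)) (+-identityʳ a)

        entry : ∀ p q → joinDiagonal (diagonalEntry x) p q + ε X * (if joinAdj link F G p q then 1# else 0#) ≈
          joinMatrix (λ i j → scalar (σ x) i j + ε X * adjacency F i j) (λ i j → ε X * linkMatrix link i j)
                     (μ x) (ε X) (ε X) (corner x) p q
        entry (u i)  (u j)  = refl
        entry (u i)  (u′ j) = trans (+-identityˡ _) (*-congˡ (reflexive (≡.cong (λ b → if b then 1# else 0#)
          (link-sym link-regular j i))))
        entry (u i)  (v j)  = 0+e*1
        entry (u′ i) (u j)  = +-identityˡ _
        entry (u′ i) (u′ j) = a+e*0 _
        entry (u′ i) (v j)  = a+e*0 _
        entry (v i)  (u j)  = 0+e*1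
        entry (v i)  (u′ j) = a+e*0 _
        entry (v i)  (v j)  = refl

      module _ (β γ κ : Carrier) where

        private
          ρ : Carrier
          ρ = r · 1#

          -- Equals `- ((y - ρ) * (z - ρ))` when `y + z` is `μ ε - β` and `y * z` is `γ - μ σ`. The
          -- sign makes it monic in `x`: its leading part is `μ σ`, a product of two factors of the
          -- form `x - a`.
          quadratic : Carrier → Carrier
          quadratic x = μ x * σ x + ρ * (μ x * ε X - β) - γ - ρ * ρ

          -- The scale factors of `det-joinMatrix` collected: `μ ^ n` from each side of the
          -- elimination, and the eigenvalue of the all-ones vector from the border.
          multiplier : Carrier → Carrier
          multiplier x = μ x * (μ x ^ n * (μ x ^ n * quadratic x))

          monic-μ^* : ∀ {d f} k → Monic d f → Monic (k ℕ.+ d) λ x → μ x ^ k * f x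
          monic-μ^* {d} zero    fm = monic-resp {d} (λ x → *-identityˡ _) fm
          monic-μ^* {d} (suc k) fm = monic-resp {suc (k ℕ.+ d)} (λ x → *-assoc _ _ _)
            (monic-[x-_]* {k ℕ.+ d} _ (monic-μ^* {d} k fm))

          degree-μ : Degree< 2 μ
          degree-μ = degree-x- _

          monic-quadratic : Monic 2 quadratic
          monic-quadratic = monic-resp {2}
            (λ x → solve 6 (λ μ σ ρ e β γ → μ :* σ :+ ρ :* (μ :* e :- β) :- γ :- ρ :* ρ :=
               μ :* (σ :* :1) :+ (ρ :* e :* μ :+ (:- (ρ :* β) :- γ :- ρ :* ρ))) refl (μ x) (σ x) ρ (ε X) β γ)
            (monic-+ {2} (monic-[x-_]* {1} _ (monic-[x-_]* {0} _ (lift λ _ → refl)))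
              (degree-+ {2} (degree-* {2} (ρ * ε X) degree-μ) (degree-const {1} (- (ρ * β) - γ - ρ * ρ))))

          monic-multiplier : Monic (suc (n ℕ.+ (n ℕ.+ 2))) multiplier
          monic-multiplier = monic-[x-_]* {n ℕ.+ (n ℕ.+ 2)} _
            (monic-μ^* {n ℕ.+ 2} n (monic-μ^* {2} n monic-quadratic))

        module _ {F H : Graph n} {link link′ : Fin n → Fin n → Bool}
                 (F-regular : Regular r F) (H-regular : Regular r H)
                 (link-regular : LinkRegular s link) (link′-regular : LinkRegular s link′)
                 (F-square : SquareRelation F link β γ κ) (H-square : SquareRelation H link′ β γ κ)
                 (F≈H : ∀ x → characteristicPolynomial (adjacency F) x ≈ characteristicPolynomial (adjacency H) x) where

          private
            φ ψ : Carrier → Carrier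
            φ = characteristicPolynomial (matrix X (splittingJoin link F G))
            ψ = characteristicPolynomial (matrix X (splittingJoin link′ H G))

            -- Here `x` is fixed, so the roots may be chosen for this `x` alone. They are gone from
            -- the conclusion, which is an identity between polynomial functions of `x`.
            difference : ∀ x → multiplier x * (φ x - ψ x) ≈ 0#
            difference x =
              -- Horner form of `t² - (μ ε - β) t + (γ - μ σ)`, whose two roots have the sum and
              -- product that `det-joinMatrix` asks for.
              let y , y-root = monic-root {1} {λ t → (γ - μ x * σ x) + t * (- (μ x * ε X - β) + t * 1#)}
                    (_ , _ , (_ , _ , lift (λ _ → refl) , λ _ → refl) , λ _ → refl)
              in cancelled y y-root
              where
              cancelled : ∀ y → (γ - μ x * σ x) + y * (- (μ x * ε X - β) + y * 1#) ≈ 0# →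
                          multiplier x * (φ x - ψ x) ≈ 0#
              cancelled y y-root = begin
                multiplier x * (φ x - ψ x)
                  ≈⟨ *-congʳ multiplier≈ ⟩
                (t * (p * p)) * (φ x - ψ x)
                  ≈⟨ solve 4 (λ t p f g → (t :* (p :* p)) :* (f :- g) := t :* (p :* f :* p) :- t :* (p :* g :* p))
                       refl t p (φ x) (ψ x) ⟩
                t * (p * φ x * p) - t * (p * ψ x * p)
                  ≈⟨ +-cong (reduced F-regular link-regular F-square) (-‿cong (reduced H-regular link′-regular H-square)) ⟩
                value F - value H
                  ≈⟨ +-congʳ (*-congʳ (*-cong (*-congˡ (F≈H y)) (F≈H z))) ⟩
                value H - value H
                  ≈⟨ -‿inverseʳ _ ⟩
                0# ∎
                where
                z t p : Carrier
                -- The second root, from the sum of the roots; the product then follows from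
                -- `y-root`.
                z = μ x * ε X - β - y
                t = - μ x * (y - ρ) * (z - ρ)
                p = μ x ^ n

                y+z : y + z ≈ μ x * ε X - β
                y+z = solve 2 (λ y b → y :+ (b :- y) := b) refl y (μ x * ε X - β)

                yz : y * z ≈ γ - μ x * σ x
                yz = begin
                  y * z
                    ≈⟨ solve 3 (λ y b e → y :* (b :- y) := e :- (e :+ y :* (:- b :+ y :* :1)))
                         refl y (μ x * ε X - β) (γ - μ x * σ x) ⟩
                  (γ - μ x * σ x) - ((γ - μ x * σ x) + y * (- (μ x * ε X - β) + y * 1#))
                    ≈⟨ +-congˡ (trans (-‿cong y-root) -0#≈0#) ⟩
                  (γ - μ x * σ x) + 0#
                    ≈⟨ +-identityʳ _ ⟩
                  γ - μ x * σ x ∎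

                multiplier≈ : multiplier x ≈ t * (p * p)
                multiplier≈ = begin
                  μ x * (p * (p * quadratic x))
                    ≈⟨ solve 6 (λ μ p σ ρ b γ → μ :* (p :* (p :* (μ :* σ :+ ρ :* b :- γ :- ρ :* ρ))) :=
                         (:- μ) :* ((γ :- μ :* σ) :- ρ :* b :+ ρ :* ρ) :* (p :* p))
                         refl (μ x) p (σ x) ρ (μ x * ε X - β) γ ⟩
                  - μ x * ((γ - μ x * σ x) - ρ * (μ x * ε X - β) + ρ * ρ) * (p * p)
                    ≈⟨ *-congʳ (*-congˡ (+-congʳ (+-cong yz (-‿cong (*-congˡ y+z))))) ⟨
                  - μ x * (y * z - ρ * (y + z) + ρ * ρ) * (p * p)
                    ≈⟨ solve 5 (λ μ y z ρ p → (:- μ) :* (y :* z :- ρ :* (y :+ z) :+ ρ :* ρ) :* p :=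
                         (:- μ) :* (y :- ρ) :* (z :- ρ) :* p) refl (μ x) y z ρ (p * p) ⟩
                  t * (p * p) ∎

                -- `E` occurs only in the two values of its characteristic polynomial, where `F` and
                -- `H` agree.
                value : Graph n → Carrier
                value E = det {n} (scalar (- μ x)) * characteristicPolynomial (adjacency E) y *
                  characteristicPolynomial (adjacency E) z *
                  joinCofactor t (- (μ x * κ)) (μ x) (μ x * ε X) (ε X * μ x) (corner x)

                reduced : ∀ {E : Graph n} {link} → Regular r E → LinkRegular s link → SquareRelation E link β γ κ →
                  t * (p * characteristicPolynomial (matrix X (splittingJoin link E G)) x * p) ≈ value E
                reduced {E} {link} E-regular link-regular E-square = trans
                  (*-congˡ (*-congʳ (*-congˡ (characteristicPolynomial-join E-regular link-regular x))))
                  (det-joinMatrix (adjacency E) (linkMatrix link) ρ β γ κ (adjacency-rowSum {F = E} E-regular)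
                    (square E-square) (σ x) (μ x) (ε X) y z (corner x) (ε² X) y+z yz)

          -- One characteristic polynomial is split into linear factors, and the list obtained
          -- serves for both, as the two polynomials agree at every point.
          join-cospectral : Cospectral X (splittingJoin link F G) (splittingJoin link′ H G)
          join-cospectral =
            let λs , length≡ , φ≈ = monic-splits {n ℕ.+ (n ℕ.+ m)}
                  (monic-characteristicPolynomial (matrix X (splittingJoin link F G)))
            in λs , record { length≡n = length≡ ; factors = φ≈ } ,
                    record { length≡n = length≡ ; factors = λ x → trans (sym (φ≈ψ x)) (φ≈ x) }
            where
            φ≈ψ : ∀ x → φ x ≈ ψ x
            φ≈ψ x = begin
              φ x                 ≈⟨ solve 2 (λ f g → f := (f :- g) :+ g) refl (φ x) (ψ x) ⟩
              (φ x - ψ x) + ψ x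
                ≈⟨ +-congʳ (monic-cancel {n ℕ.+ (n ℕ.+ m)} {suc (n ℕ.+ (n ℕ.+ 2))} monic-multiplier
                     (monic-difference {n ℕ.+ (n ℕ.+ m)}
                       (monic-characteristicPolynomial (matrix X (splittingJoin link F G)))
                       (monic-characteristicPolynomial (matrix X (splittingJoin link′ H G)))) difference x) ⟩
              0# + ψ x            ≈⟨ +-identityˡ _ ⟩
              ψ x                 ∎

-- The equality of orders is a separate argument so that matching on it puts both graphs on one
-- vertex set.
sameOrder : ∀ {c ℓ₁ ℓ₂} (K : AlgebraicallyClosedCharZeroField c ℓ₁ ℓ₂) → let open Spectra K in
  ∀ {n n′} r (F : Graph n) (H : Graph n′) → n ≡ n′ → Regular r F → Regular r H →
  ¬ (F ≅ H) → Cospectral A F H → ∀ {m} (G : Graph m) →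
  NICS (A ∷ Q ∷ L ∷ []) (F ⊻ G) (H ⊻ G) × NICS (A ∷ Q ∷ L ∷ []) (F ⩣ G) (H ⩣ G)
sameOrder K {n} r F H ≡.refl F-regular H-regular F≇H (λs , F-spectrum , H-spectrum) G =
  (⊻-≇ {F = F} {H} G F-regular H-regular F≇H , λ X _ →
    join-cospectral X r r G _ _ _ {F} {H} F-regular H-regular
      (adj-linkRegular {F = F} F-regular) (adj-linkRegular {F = H} H-regular) (adj-square F) (adj-square H) F≈H) ,
  (⩣-≇ {F = F} {H} G F-regular H-regular F≇H , λ X _ →
    join-cospectral X r (n ℕ.∸ suc r) G _ _ _ {F} {H} F-regular H-regular
      (nonNeighbour-linkRegular {F = F} F-regular) (nonNeighbour-linkRegular {F = H} H-regular)
      (nonNeighbour-square {F = F} F-regular) (nonNeighbour-square {F = H} H-regular) F≈H)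
  where
  open SplittingJoinSpectrum K
  open Spectra K using (characteristicPolynomial; adjacency; module IsSpectrum)
  open AlgebraicallyClosedCharZeroField K using (_≈_; sym; trans)

  F≈H : ∀ x → characteristicPolynomial (adjacency F) x ≈ characteristicPolynomial (adjacency H) x
  F≈H x = trans (IsSpectrum.factors F-spectrum x) (sym (IsSpectrum.factors H-spectrum x))

corollary4p5 : ∀ {c ℓ₁ ℓ₂} (K : AlgebraicallyClosedCharZeroField c ℓ₁ ℓ₂) →
    let open Spectra K in
    ∀ {n n′ : ℕ} (r : ℕ) (F : Graph n) (H : Graph n′) →
    Regular r F → Regular r H →
    ¬ (F ≅ H) → Cospectral A F H →
    ∀ {m : ℕ} (G : Graph m) →
    NICS (A ∷ Q ∷ L ∷ []) (F ⊻ G) (H ⊻ G) ×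
    NICS (A ∷ Q ∷ L ∷ []) (F ⩣ G) (H ⩣ G)
corollary4p5 K r F H F-regular H-regular F≇H cospectral@(λs , F-spectrum , H-spectrum) =
  -- The common list of eigenvalues has as many entries as either graph has vertices.
  sameOrder K r F H (≡.trans (≡.sym (IsSpectrum.length≡n F-spectrum)) (IsSpectrum.length≡n H-spectrum))
    F-regular H-regular F≇H cospectral
  where open Spectra K using (module IsSpectrum)
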